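{- Let the Super Harmonic algorithm (with arbitrary admissible parameters as described in the context) be run on a list $L$ of items with sizes in $(0,1]$, and let $A(L)$ be the number of bins it uses. Let $W^1,\dots,W^{K+1}$ be the weighting functions defined in the context. Then \[ A(L)\le \max_{1\le i\le K+1}\Big\{\sum_{p\in L} W^i(p)\Big\}+O(1), \] where the $O(1)$ term depends only on the parameters of the algorithm and not on $L$.
   Context: One-dimensional online bin packing: items with sizes in $(0,1]$ arrive one by one and must be irrevocably placed into bins of capacity $1$. Super Harmonic algorithm. Parameters: an integer $k\ge1$, reals $t_1=1>t_2>\dots>t_k>t_{k+1}=\epsilon>t_{k+2}=0$, intervals $I_i=(t_{i+1},t_i]$ for $i=1,\dots,k+1$ (an item of size $x$ is of type $i$ if $x\in I_i$), and constants $\alpha_1,\dots,\alpha_k\in[0,1]$. Let $\beta_i=\lfloor 1/t_i\rfloor$ and $\delta_i=1-t_i\beta_i$. Fix reals $0=\Delta_0<\Delta_1<\dots<\Delta_K<1/2$ with $K\le k$ and a map $\phi:\{1,\dots,k\}\to\{0,\dots,K\}$ with $\Delta_{\phi(i)}\le\delta_i$. Let $\varphi(i)=\min\{j: t_i\le\Delta_j,\ 1\le j\le K\}$ (and $\varphi(i)=0$ if $t_i>\Delta_K$). Let $\gamma_i=0$ if $t_i>\Delta_K$, and otherwise $\gamma_i=\max\{1,\lfloor\Delta_1/t_i\rfloor\}$. Bins are named in groups: $(i)$ for $\phi(i)=0$ (only blue type-$i$ items); $(i,?)$ for $\phi(i)\neq0$ (currently only blue type-$i$ items); $(?,j)$ for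 $\alpha_j\ne0$ (currently only red type-$j$ items); $(i,j)$ for $\phi(i)\ne0,\alpha_j\ne0,\gamma_jt_j\le\Delta_{\phi(i)}$ (blue type-$i$ and red type-$j$ items). Counters $s_i,e_i$ start at $0$. For each arriving item $p$ of type $i$: (a) if $i=k+1$, pack $p$ by Next Fit into bins reserved for type $k+1$; (b) otherwise set $s_i\gets s_i+1$; if $e_i<\lfloor\alpha_is_i\rfloor$ then set $e_i\gets e_i+1$ and color $p$ red: if some bin in group $(?,i)$ has fewer than $\gamma_i$ type-$i$ items, put $p$ there; else if for some $j$ a bin in group $(j,i)$ has fewer than $\gamma_i$ type-$i$ items, put $p$ there; else if some bin in group $(j,?)$ has $\Delta_{\phi(j)}\ge\gamma_it_i$, put $p$ there and rename the bin $(j,i)$; otherwise open a new bin $(?,i)$ for $p$. (c) otherwise color $p$ blue: if $\phi(i)=0$, put $p$ into a group-$(i)$ bin with fewer than $\beta_i$ items if one exists, else open a new group-$(i)$ bin. If $\phi(i)\ne0$: if for some $j$ a bin in group $(i,j)$ or $(i,?)$ has fewer than $\beta_i$ type-$i$ items, put $p$ there; else if some bin in group $(?,j)$ has $\Delta_{\phi(i)}\ge\gamma_jt_j$, put $p$ there and rename it $(i,j)$; otherwise open a new bin $(i,?)$ for $p$. Weighting functions. In all formulas below a term $\alpha_i/\gamma_i$ or $\alpha_i/(2\gamma_i)$ is replaced by $0$ when $\gamma_i=0$. For $x\in I_{k+1}$, $W^j(x)=x/(1-\epsilon)$ for every $j$. For $x\in I_i$, $1\le i\le k$: $W^1(x)=\frac{1-\alpha_i}{\beta_i}$.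 For $2\le j\le K$, $W^{K+2-j}(x)$ equals $\frac{1-\alpha_i}{\beta_i}+\frac{\alpha_i}{2\gamma_i}$ if $\phi(i)<j,\varphi(i)<j$; $\frac{1-\alpha_i}{\beta_i}+\frac{\alpha_i}{\gamma_i}$ if $\phi(i)<j,\varphi(i)\ge j$; $\frac{1-\alpha_i}{2\beta_i}+\frac{\alpha_i}{\gamma_i}$ if $\phi(i)\ge j,\varphi(i)\ge j$; $\frac{1-\alpha_i}{2\beta_i}+\frac{\alpha_i}{2\gamma_i}$ if $\phi(i)\ge j,\varphi(i)<j$. $W^{K+1}(x)$ equals $\frac{1-\alpha_i}{\beta_i}$ if $\phi(i)=0,\varphi(i)=0$; $\frac{1-\alpha_i}{\beta_i}+\frac{\alpha_i}{\gamma_i}$ if $\phi(i)=0,\varphi(i)>0$; $0$ if $\phi(i)>0,\varphi(i)=0$; $\frac{\alpha_i}{\gamma_i}$ if $\phi(i)>0,\varphi(i)>0$.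
   Formalization: The formal statement adds the condition that α_i = 0 whenever t_i > Δ_K (that is, γ_i = 0); without it the claim fails, e.g. α_1 = 1 and n items of size 1 open n bins of total weight 0. -}

module Defs where

open import Algebra.Bundles using (CommutativeRing)
import Algebra.Definitions.RawMonoid as RawMonoidMult
open import Data.Bool.Base using (if_then_else_)
open import Data.Fin.Base using (Fin; zero; suc; toℕ; fromℕ; inject₁)
import Data.Fin.Properties as Fin
open import Data.Fin.Relation.Unary.Top using (view; ‵fromℕ; ‵inject₁)
import Data.List.Extrema as Extrema
open import Data.List.Base as List using (List; []; _∷_; length; filter; find; foldr; allFin; applyUpTo)
open import Data.List.Membership.Propositional using (_∈_; _∷=_)
open import Data.List.Relation.Unary.Any using (Any)
open import Data.Maybe.Base using (fromMaybe)
open import Data.Nat.Base as ℕ using (ℕ; zero; suc; _∸_)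
import Data.Nat.Properties as ℕ
open import Data.Product.Base using (∃; _×_; _,_; proj₁; proj₂)
open import Data.Sum.Base using (_⊎_)
import Data.Vec.Functional as Vector
open import Level using (_⊔_) renaming (suc to lsuc)
open import Relation.Binary.Bundles using (TotalOrder)
open import Relation.Binary.Core using (Rel)
import Relation.Binary.Construct.NonStrictToStrict as NonStrictToStrict
open import Relation.Binary.Definitions using (Decidable)
open import Relation.Binary.PropositionalEquality.Core using (_≡_; _≢_)
open import Relation.Binary.Structures using (IsDecTotalOrder)
open import Relation.Nullary.Decidable using (does; yes; no)
open import Relation.Nullary.Negation using (¬_; contradiction)

-- Sizes and parameters range over an arbitrary Archimedean ordered field.
-- Classically ℝ is one, so the case of real sizes is an instance.
record ArchimedeanOrderedField c ℓ₁ ℓ₂ : Set (lsuc (c ⊔ ℓ₁ ⊔ ℓ₂)) where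
  infix  8 _⁻¹
  infixl 7 _/_
  infix  4 _≤_
  field
    commutativeRing : CommutativeRing c ℓ₁

  open CommutativeRing commutativeRing public
    using (Carrier; _≈_; _≉_; _+_; _*_; -_; _-_; 0#; 1#)

  open RawMonoidMult (CommutativeRing.+-rawMonoid commutativeRing)
    renaming (_×_ to _·_) using ()

  ι : ℕ → Carrier
  ι n = n · 1#

  -- 0# ⁻¹ is unconstrained.
  field
    _≤_             : Rel Carrier ℓ₂
    _⁻¹             : Carrier → Carrier
    0≉1             : 0# ≉ 1#
    *-inverseʳ      : ∀ x → x ≉ 0# → x * x ⁻¹ ≈ 1#
    isDecTotalOrder : IsDecTotalOrder _≈_ _≤_
    +-monoˡ-≤       : ∀ {x y} z → x ≤ y → x + z ≤ y + z
    *-nonNegative   : ∀ {x y} → 0# ≤ x → 0# ≤ y → 0# ≤ x * y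
    archimedean     : ∀ x → ∃ λ n → x ≤ ι n

  open IsDecTotalOrder isDecTotalOrder public using (_≤?_; _≟_; isTotalOrder)

  totalOrder : TotalOrder c ℓ₁ ℓ₂
  totalOrder = record { isTotalOrder = isTotalOrder }

  open NonStrictToStrict _≈_ _≤_ public using (_<_)

  _<?_ : Decidable _<_
  _<?_ = NonStrictToStrict.<-decidable _≈_ _≤_ _≟_ _≤?_

  ≮⇒≥ : ∀ {x y} → ¬ (x < y) → y ≤ x
  ≮⇒≥ = NonStrictToStrict.≮⇒≥ _≈_ _≤_
    Eq.sym _≟_ (IsDecTotalOrder.reflexive isDecTotalOrder)
    (IsDecTotalOrder.total isDecTotalOrder)
    where module Eq = CommutativeRing commutativeRing

  <⇒≱ : ∀ {x y} → x < y → ¬ (y ≤ x)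
  <⇒≱ = NonStrictToStrict.<⇒≱ _≈_ _≤_ (IsDecTotalOrder.antisym isDecTotalOrder)

  _/_ : Carrier → Carrier → Carrier
  x / y = x * y ⁻¹

  greatestUpTo : ℕ → Carrier → ℕ
  greatestUpTo zero    x = zero
  greatestUpTo (suc n) x = if does (ι (suc n) ≤? x) then suc n else greatestUpTo n x

  -- The floor of a non-negative x (negative x give 0).
  ⌊_⌋ : Carrier → ℕ
  ⌊ x ⌋ = greatestUpTo (proj₁ (archimedean x)) x

module _ {c ℓ₁ ℓ₂} (F : ArchimedeanOrderedField c ℓ₁ ℓ₂) where
  open ArchimedeanOrderedField F

  -- Types 1, …, k+1 are the elements of Fin (suc k), and types 1, …, k those of
  -- Fin k, embedded by inject₁; both are numbered from zero.  Indices of Δ are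
  -- literal: zero stands for Δ₀.
  record Parameters : Set (c ⊔ ℓ₁ ⊔ ℓ₂) where
    field
      k      : ℕ
      1≤k    : 1 ℕ.≤ k
      t      : Fin (2 ℕ.+ k) → Carrier
      t-head : t zero ≈ 1#
      t-last : t (fromℕ (suc k)) ≈ 0#
      t-decr : ∀ i → t (suc i) < t (inject₁ i)
      α      : Fin k → Carrier
      0≤α    : ∀ i → 0# ≤ α i
      α≤1    : ∀ i → α i ≤ 1#

    ε : Carrier
    ε = t (inject₁ (fromℕ k))

    τ : Fin k → Carrier
    τ i = t (inject₁ (inject₁ i))

    β : Fin k → ℕ
    β i = ⌊ 1# / τ i ⌋

    δ : Fin k → Carrier
    δ i = 1# - τ i * ι (β i)

    field
      K      : ℕ
      K≤k    : K ℕ.≤ k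
      Δ      : Fin (suc K) → Carrier
      Δ-head : Δ zero ≈ 0#
      Δ-incr : ∀ j → Δ (inject₁ j) < Δ (suc j)
      Δ-last : Δ (fromℕ K) < 1# / ι 2
      φ      : Fin k → Fin (suc K)
      Δφ≤δ   : ∀ i → Δ (φ i) ≤ δ i
      -- γ i = 0 means that no item of type i may be coloured red.  Without this
      -- condition, α zero = 1 would give items of the first type weight 0 although
      -- each of them may open a new bin.
      α-zero : ∀ i → Δ (fromℕ K) < τ i → α i ≈ 0#

module SuperHarmonic {c ℓ₁ ℓ₂} (F : ArchimedeanOrderedField c ℓ₁ ℓ₂) (P : Parameters F) where
  open ArchimedeanOrderedField F
  open Parameters P

  -- The least j ≥ 1 with τ i ≤ Δ j, or 0 if there is none, i.e. if Δ_K < τ i.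
  varphi : Fin k → Fin (suc K)
  varphi i = fromMaybe zero (find (λ j → τ i ≤? Δ j) (List.map suc (allFin K)))

  -- Δ₁; for K = 0 the value is never used, as then Δ_K = 0 < τ i.
  at1 : ∀ {n} → (Fin (suc n) → Carrier) → Carrier
  at1 {zero}  u = u zero
  at1 {suc _} u = u (suc zero)

  γ : Fin k → ℕ
  γ i = if does (τ i ≤? Δ (fromℕ K)) then 1 ℕ.⊔ ⌊ at1 Δ / τ i ⌋ else 0

  record Item : Set (c ⊔ ℓ₁ ⊔ ℓ₂) where
    field
      size   : Carrier
      0<size : 0# < size
      size≤1 : size ≤ 1#
  open Item public

  _∈I_ : Carrier → Fin (suc k) → Set (ℓ₁ ⊔ ℓ₂)
  x ∈I i = t (suc i) < x × x ≤ t (inject₁ i)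

  locate : ∀ {n} (u : Fin (suc n) → Carrier) x → x ≤ u zero → u (fromℕ n) < x →
           ∃ λ (i : Fin n) → u (suc i) < x × x ≤ u (inject₁ i)
  locate {zero}  u x x≤u u<x = contradiction x≤u (<⇒≱ u<x)
  locate {suc n} u x x≤u u<x with u (suc zero) <? x
  ... | yes u₁<x = zero , u₁<x , x≤u
  ... | no  u₁≮x with locate (λ i → u (suc i)) x (≮⇒≥ u₁≮x) u<x
  ...   | i , p = suc i , p

  classify : (p : Item) → ∃ λ i → size p ∈I i
  classify p = locate t (size p)
    (≤-respʳ-≈ (sym t-head) (size≤1 p))
    ( ≤-respˡ-≈ (sym t-last) (proj₁ (0<size p))
    , λ eq → proj₂ (0<size p) (trans (sym t-last) eq))
    where
    open IsDecTotalOrder isDecTotalOrder using (≤-respʳ-≈; ≤-respˡ-≈)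
    open CommutativeRing commutativeRing using (sym; trans)

  type : Item → Fin (suc k)
  type p = proj₁ (classify p)

  data Group : Set where
    only  : Fin k → Group            -- (i)
    blue? : Fin k → Group            -- (i,?)
    red?  : Fin k → Group            -- (?,j)
    mixed : Fin k → Fin k → Group    -- (i,j): blue type i, red type j

  record Bin : Set (c ⊔ ℓ₁ ⊔ ℓ₂) where
    constructor bin
    field
      group : Group
      items : List Item
  open Bin public

  count : Fin k → Bin → ℕ
  count i b = length (filter (λ q → type q Fin.≟ inject₁ i) (items b))

  -- Where the algorithm says "some bin", every choice is allowed.

  module _ (i : Fin k) where
    RedPure RedMixed RedMatch BluePartial BlueMatch OnlyPartial : Bin → Set _
    RedPure     b = group b ≡ red? i × count i b ℕ.< γ i
    RedMixed    b = (∃ λ j → group b ≡ mixed j i) × count i b ℕ.< γ i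
    RedMatch    b = ∃ λ j → group b ≡ blue? j × ι (γ i) * τ i ≤ Δ (φ j)
    OnlyPartial b = group b ≡ only i × count i b ℕ.< β i
    BluePartial b = ((∃ λ j → group b ≡ mixed i j) ⊎ group b ≡ blue? i) × count i b ℕ.< β i
    BlueMatch   b = ∃ λ j → group b ≡ red? j × ι (γ j) * τ j ≤ Δ (φ i)

  add : Item → Bin → Bin
  add p b = bin (group b) (p ∷ items b)

  data PlaceRed (i : Fin k) (p : Item) (B : List Bin) : List Bin → Set (c ⊔ ℓ₁ ⊔ ℓ₂) where
    pure  : ∀ {b} (b∈ : b ∈ B) → RedPure i b →
            PlaceRed i p B (b∈ ∷= add p b)
    mixed : ¬ Any (RedPure i) B →
            ∀ {b} (b∈ : b ∈ B) → RedMixed i b →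
            PlaceRed i p B (b∈ ∷= add p b)
    match : ¬ Any (RedPure i) B → ¬ Any (RedMixed i) B →
            ∀ {b} (b∈ : b ∈ B) ((j , _) : RedMatch i b) →
            PlaceRed i p B (b∈ ∷= bin (mixed j i) (p ∷ items b))
    new   : ¬ Any (RedPure i) B → ¬ Any (RedMixed i) B → ¬ Any (RedMatch i) B →
            PlaceRed i p B (bin (red? i) (p ∷ []) ∷ B)

  data PlaceBlue (i : Fin k) (p : Item) (B : List Bin) : List Bin → Set (c ⊔ ℓ₁ ⊔ ℓ₂) where
    only    : φ i ≡ zero →
              ∀ {b} (b∈ : b ∈ B) → OnlyPartial i b →
              PlaceBlue i p B (b∈ ∷= add p b)
    newOnly : φ i ≡ zero → ¬ Any (OnlyPartial i) B →
              PlaceBlue i p B (bin (only i) (p ∷ []) ∷ B)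
    partial : φ i ≢ zero →
              ∀ {b} (b∈ : b ∈ B) → BluePartial i b →
              PlaceBlue i p B (b∈ ∷= add p b)
    match   : φ i ≢ zero → ¬ Any (BluePartial i) B →
              ∀ {b} (b∈ : b ∈ B) ((j , _) : BlueMatch i b) →
              PlaceBlue i p B (b∈ ∷= bin (mixed i j) (p ∷ items b))
    new     : φ i ≢ zero → ¬ Any (BluePartial i) B → ¬ Any (BlueMatch i) B →
              PlaceBlue i p B (bin (blue? i) (p ∷ []) ∷ B)

  sumOver : (Item → Carrier) → List Item → Carrier
  sumOver f = foldr (λ p x → f p + x) 0#

  -- The head of the list is the currently open bin.
  data NextFit (p : Item) : List (List Item) → List (List Item) → Set (c ⊔ ℓ₁ ⊔ ℓ₂) where
    first : NextFit p [] ((p ∷ []) ∷ [])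
    fits  : ∀ {b bs} → size p + sumOver size b ≤ 1# →
            NextFit p (b ∷ bs) ((p ∷ b) ∷ bs)
    next  : ∀ {b bs} → ¬ (size p + sumOver size b ≤ 1#) →
            NextFit p (b ∷ bs) ((p ∷ []) ∷ b ∷ bs)

  record State : Set (c ⊔ ℓ₁ ⊔ ℓ₂) where
    constructor state
    field
      s e   : Fin k → ℕ
      bins  : List Bin
      small : List (List Item)   -- the bins reserved for type k+1

  initial : State
  initial = state (λ _ → 0) (λ _ → 0) [] []

  increment : Fin k → (Fin k → ℕ) → (Fin k → ℕ)
  increment i f = Vector.updateAt f i suc

  data Step (p : Item) : State → State → Set (c ⊔ ℓ₁ ⊔ ℓ₂) where
    small : ∀ {s e B S S′} → type p ≡ fromℕ k → NextFit p S S′ →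
            Step p (state s e B S) (state s e B S′)
    red   : ∀ {s e B B′ S} i → type p ≡ inject₁ i →
            e i ℕ.< ⌊ α i * ι (suc (s i)) ⌋ → PlaceRed i p B B′ →
            Step p (state s e B S) (state (increment i s) (increment i e) B′ S)
    blue  : ∀ {s e B B′ S} i → type p ≡ inject₁ i →
            ¬ (e i ℕ.< ⌊ α i * ι (suc (s i)) ⌋) → PlaceBlue i p B B′ →
            Step p (state s e B S) (state (increment i s) e B′ S)

  data Run : List Item → State → State → Set (c ⊔ ℓ₁ ⊔ ℓ₂) where
    []  : ∀ {σ} → Run [] σ σ
    _∷_ : ∀ {p L σ σ′ σ″} → Step p σ σ′ → Run L σ′ σ″ → Run (p ∷ L) σ σ″

  binsUsed : State → ℕ
  binsUsed σ = length (State.bins σ) ℕ.+ length (State.small σ)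

  blueShare redShare : ℕ → Fin k → Carrier
  blueShare m i = (1# - α i) / ι (m ℕ.* β i)
  redShare  m i with γ i
  ... | zero  = 0#
  ... | suc g = α i / ι (m ℕ.* suc g)

  firstWeight : Fin k → Carrier
  firstWeight i = blueShare 1 i

  -- The weight of a type-i item under W^{K+2-j}, for 2 ≤ j ≤ K.
  middleWeight : ℕ → Fin k → Carrier
  middleWeight j i with toℕ (φ i) ℕ.<? j | toℕ (varphi i) ℕ.<? j
  ... | yes _ | yes _ = blueShare 1 i + redShare 2 i
  ... | yes _ | no  _ = blueShare 1 i + redShare 1 i
  ... | no  _ | no  _ = blueShare 2 i + redShare 1 i
  ... | no  _ | yes _ = blueShare 2 i + redShare 2 i

  lastWeight : Fin k → Carrier
  lastWeight i with φ i | varphi i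
  ... | zero  | zero  = blueShare 1 i
  ... | zero  | suc _ = blueShare 1 i + redShare 1 i
  ... | suc _ | zero  = 0#
  ... | suc _ | suc _ = redShare 1 i

  typeWeight : ℕ → Fin k → Carrier
  typeWeight n with n ℕ.≟ 1 | n ℕ.≟ suc K
  ... | yes _ | _     = firstWeight
  ... | no  _ | yes _ = lastWeight
  ... | no  _ | no  _ = middleWeight (K ℕ.+ 2 ∸ n)

  -- W n is Wⁿ for 1 ≤ n ≤ K+1; other n are not used.  When K = 0 the clauses for
  -- W¹ and W^{K+1} agree, because then φ i = varphi i = 0.
  W : ℕ → Item → Carrier
  W n p = weightAt (type p)
    where
    weightAt : Fin (suc k) → Carrier
    weightAt i with view i
    ... | ‵fromℕ      = size p / (1# - ε)
    ... | ‵inject₁ i′ = typeWeight n i′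

  maxWeight : List Item → Carrier
  maxWeight L = max (sumOver (W 1) L) (applyUpTo (λ m → sumOver (W (2 ℕ.+ m)) L) K)
    where open Extrema totalOrder using (max)

{-# OPTIONS --safe #-}
module Submission where

-- All but a bounded number of the bins with blue (red) items of type i hold β i (γ i)
-- of them, and about (1 - α i) s i of the s i items of type i are blue.  Hence, up to a
-- constant, the weight of the list counts every bin with a factor u i for its blue type i
-- plus a factor v j for its red type j, and it suffices to choose the weighting function
-- for which every bin receives at least 1.  If no bin (?,j) remains, W¹ (u = 1, v = 0)
-- does this.  Otherwise let h be the least varphi j over the remaining bins (?,j).  As
-- bins (i,?) and (?,j) that fit do not coexist, φ i < h for every remaining bin (i,?), so
-- bins (i,?) and (?,j) get factor 1 under W^{K+2-h}, and a bin (i,j) gets 1/2 + 1/2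
-- for h ≥ 2 and v j = 1 for h = 1.

open import Defs
open import Algebra.Bundles using (CommutativeRing)
import Algebra.Properties.Ring as RingProperties
import Algebra.Properties.Semiring.Mult as SemiringMult
import Algebra.Properties.Semiring.Sum as SemiringSum
import Algebra.Solver.Ring.NaturalCoefficients.Default as RingSolver
open import Data.Bool.Base using (true; false; if_then_else_)
open import Data.Fin.Base using (Fin; zero; suc; toℕ; fromℕ; inject₁)
import Data.Fin.Properties as Fin
open import Data.Fin.Relation.Unary.Top using (view-fromℕ; view-inject₁)
open import Data.List.Base as List using (List; []; _∷_; length; find; applyUpTo)
import Data.List.Extrema as Extrema
open import Data.List.Membership.Propositional using (_∈_; _∷=_; lose) renaming (find to find∈)
open import Data.List.Membership.Propositional.Properties using (∈-allFin; ∈-map⁻; ∈-applyUpTo⁺)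
open import Data.List.Properties using (filter-accept; filter-reject)
open import Data.List.Relation.Unary.All as All using (All; []; _∷_)
open import Data.List.Relation.Unary.Any as Any using (Any; here; there)
open import Data.List.Relation.Unary.Any.Properties using (map⁺; Any-⊎⁻)
open import Data.Maybe.Base using (Maybe; just; nothing; fromMaybe; maybe′)
open import Data.Maybe.Properties using (just-injective; ≡-dec)
open import Data.Nat.Base as ℕ using (ℕ; zero; suc; _∸_; z≤n; s≤s)
import Data.Nat.ListAction as ℕ
import Data.Nat.Properties as ℕ
open import Data.Nat.Solver using () renaming (module +-*-Solver to ℕSolver)
open import Data.Product.Base using (∃; _×_; _,_; proj₁; proj₂)
open import Data.Sum.Base using (_⊎_; inj₁; inj₂)
open import Data.Vec.Functional.Properties using (updateAt-updates; updateAt-minimal)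
open import Function.Base using (_∘_; id; const; flip; case_of_)
open import Level using (_⊔_)
open import Relation.Binary.Bundles using (Poset)
import Relation.Binary.Construct.NonStrictToStrict as NonStrictToStrict
open import Relation.Binary.Core using (Rel)
open import Relation.Binary.Definitions using (Reflexive; Transitive)
import Relation.Binary.Reasoning.PartialOrder as PosetReasoning
open import Relation.Binary.PropositionalEquality as ≡ using (_≡_; _≢_)
open import Relation.Binary.Structures using (IsDecTotalOrder)
open import Relation.Nullary.Decidable using (Dec; does; yes; no; dec-true; dec-false)
open import Relation.Nullary.Negation using (¬_; contradiction)

-- The obstacle is that weights see only types, whereas bins are counted by colour, and "some bin"
-- leaves the choice of bin open. The invariant therefore speaks only of sums over the bins holding
-- one colour of one type, and of which groups coexist, so no choice has to be tracked. The test
-- `e i < ⌊α i * s i⌋` then ties the number of red items to `s i`, up to one item. Each weighting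
-- function has the form `u i * blueShare 1 i + v i * redShare 1 i` on type `i` with factors in
-- [0,1], so a single estimate serves all of them, and the function can be chosen after the run,
-- from its final bins.

module OrderedFieldProperties {c ℓ₁ ℓ₂} (F : ArchimedeanOrderedField c ℓ₁ ℓ₂) where
  open ArchimedeanOrderedField F
  open CommutativeRing commutativeRing public
    using (refl; sym; trans; +-cong; +-congˡ; +-congʳ; *-congˡ; *-congʳ;
           +-comm; +-assoc; *-comm; *-assoc; +-identityˡ; +-identityʳ; -‿inverseʳ; -‿inverseˡ;
           *-identityˡ; *-identityʳ; distribˡ; distribʳ; zeroˡ; zeroʳ; reflexive)
  open CommutativeRing commutativeRing using (ring; semiring; commutativeSemiring; -‿cong)
  open RingProperties ring using (-‿distribˡ-*; -‿involutive)
  open SemiringMult semiring using (×-homo-+; ×1-homo-*)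
  open IsDecTotalOrder isDecTotalOrder public
    using (antisym; total; ≤-respʳ-≈; ≤-respˡ-≈)
    renaming (refl to ≤-refl; trans to ≤-trans; reflexive to ≤-reflexive)
  open SemiringSum semiring public using (sum; sum-cong-≋; ∑-distrib-+)
  module Solver = RingSolver commutativeSemiring

  -- Arithmetic of the ordered field: cancellation, inverses, floors, finite sums.

  poset : Poset c ℓ₁ ℓ₂
  poset = record { isPartialOrder = IsDecTotalOrder.isPartialOrder isDecTotalOrder }

  module ≤-Reasoning = PosetReasoning poset

  <-≤-trans : ∀ {x y z} → x < y → y ≤ z → x < z
  <-≤-trans = NonStrictToStrict.<-≤-trans _≈_ _≤_ sym ≤-trans antisym ≤-respʳ-≈

  ≤-<-trans : ∀ {x y z} → x ≤ y → y < z → x < z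
  ≤-<-trans = NonStrictToStrict.≤-<-trans _≈_ _≤_ ≤-trans antisym ≤-respˡ-≈

  <⇒≤ : ∀ {x y} → x < y → x ≤ y
  <⇒≤ = proj₁

  ≰⇒> : ∀ {x y} → ¬ (x ≤ y) → y < x
  ≰⇒> {x} {y} x≰y with total x y
  ... | inj₁ x≤y = contradiction x≤y x≰y
  ... | inj₂ y≤x = y≤x , λ eq → x≰y (≤-reflexive (sym eq))

  >⇒≉0 : ∀ {x} → 0# < x → x ≉ 0#
  >⇒≉0 (_ , 0≉x) x≈0 = 0≉x (sym x≈0)

  +-monoʳ-≤ : ∀ {x y} z → x ≤ y → z + x ≤ z + y
  +-monoʳ-≤ z x≤y = ≤-respˡ-≈ (+-comm _ z) (≤-respʳ-≈ (+-comm _ z) (+-monoˡ-≤ z x≤y))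

  +-mono-≤ : ∀ {x y u v} → x ≤ y → u ≤ v → x + u ≤ y + v
  +-mono-≤ x≤y u≤v = ≤-trans (+-monoˡ-≤ _ x≤y) (+-monoʳ-≤ _ u≤v)

  x+y-y≈x : ∀ x y → x + y - y ≈ x
  x+y-y≈x x y = trans (+-assoc x y (- y)) (trans (+-congˡ (-‿inverseʳ y)) (+-identityʳ x))

  x-y+y≈x : ∀ x y → x - y + y ≈ x
  x-y+y≈x x y = trans (+-assoc x (- y) y) (trans (+-congˡ (-‿inverseˡ y)) (+-identityʳ x))

  +-cancelʳ-≤ : ∀ {x y} z → x + z ≤ y + z → x ≤ y
  +-cancelʳ-≤ z p = ≤-respˡ-≈ (x+y-y≈x _ z) (≤-respʳ-≈ (x+y-y≈x _ z) (+-monoˡ-≤ (- z) p))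

  0≤y-x : ∀ {x y} → x ≤ y → 0# ≤ y - x
  0≤y-x {x} x≤y = ≤-respˡ-≈ (-‿inverseʳ x) (+-monoˡ-≤ (- x) x≤y)

  x≤0⇒0≤-x : ∀ {x} → x ≤ 0# → 0# ≤ - x
  x≤0⇒0≤-x x≤0 = ≤-respʳ-≈ (+-identityˡ _) (0≤y-x x≤0)

  *-monoˡ-≤ : ∀ {x y z} → 0# ≤ z → x ≤ y → z * x ≤ z * y
  *-monoˡ-≤ {x} {y} {z} 0≤z x≤y = begin
    z * x                ≈⟨ +-identityˡ _ ⟨
    0# + z * x           ≤⟨ +-monoˡ-≤ (z * x) (*-nonNegative 0≤z (0≤y-x x≤y)) ⟩
    z * (y - x) + z * x  ≈⟨ distribˡ z (y - x) x ⟨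
    z * (y - x + x)      ≈⟨ *-congˡ (x-y+y≈x y x) ⟩
    z * y                ∎
    where open ≤-Reasoning

  *-monoʳ-≤ : ∀ {x y z} → 0# ≤ z → x ≤ y → x * z ≤ y * z
  *-monoʳ-≤ 0≤z x≤y = ≤-respˡ-≈ (*-comm _ _) (≤-respʳ-≈ (*-comm _ _) (*-monoˡ-≤ 0≤z x≤y))

  0≤1 : 0# ≤ 1#
  0≤1 with total 0# 1#
  ... | inj₁ 0≤1 = 0≤1
  -- If 1 were at most 0, then -1 would be non-negative, and so would its square, which is 1.
  ... | inj₂ 1≤0 = ≤-respʳ-≈ eq (*-nonNegative 0≤-1 0≤-1)
    where
    0≤-1 = x≤0⇒0≤-x 1≤0
    eq : - 1# * - 1# ≈ 1#
    eq = trans (sym (-‿distribˡ-* 1# (- 1#))) (trans (-‿cong (*-identityˡ _)) (-‿involutive 1#))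

  0<1 : 0# < 1#
  0<1 = 0≤1 , 0≉1

  0≤ι : ∀ n → 0# ≤ ι n
  0≤ι zero    = ≤-refl
  0≤ι (suc n) = ≤-respˡ-≈ (+-identityˡ 0#) (+-mono-≤ 0≤1 (0≤ι n))

  x≤1+x : ∀ x → x ≤ 1# + x
  x≤1+x x = ≤-respˡ-≈ (+-identityˡ x) (+-monoˡ-≤ x 0≤1)

  ι-mono-≤ : ∀ {m n} → m ℕ.≤ n → ι m ≤ ι n
  ι-mono-≤ {n = n} z≤n = 0≤ι n
  ι-mono-≤ (s≤s m≤n)  = +-monoʳ-≤ 1# (ι-mono-≤ m≤n)

  1≤ι : ∀ n → n ≢ 0 → 1# ≤ ι n
  1≤ι zero    n≢0 = contradiction ≡.refl n≢0
  1≤ι (suc n) _   = ≤-respˡ-≈ (+-identityʳ 1#) (ι-mono-≤ {1} {suc n} (s≤s z≤n))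

  0<ι : ∀ n → n ≢ 0 → 0# < ι n
  0<ι n n≢0 = <-≤-trans 0<1 (1≤ι n n≢0)

  ι-+ : ∀ m n → ι (m ℕ.+ n) ≈ ι m + ι n
  ι-+ = ×-homo-+ 1#

  ι-* : ∀ m n → ι (m ℕ.* n) ≈ ι m * ι n
  ι-* = ×1-homo-*

  ι1≈1 : ι 1 ≈ 1#
  ι1≈1 = +-identityʳ 1#

  ιn<ι[1+n] : ∀ n → ι n < ι (suc n)
  ιn<ι[1+n] n = x≤1+x (ι n) , λ eq → 0≉1
    (trans (sym (-‿inverseʳ (ι n))) (trans (+-congʳ eq) (x+y-y≈x 1# (ι n))))

  ι-cancel-< : ∀ m n → ι m < ι n → m ℕ.< n
  ι-cancel-< m n ιm<ιn = ℕ.≰⇒> (λ n≤m → <⇒≱ ιm<ιn (ι-mono-≤ n≤m))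

  0<x⇒0≤x⁻¹ : ∀ {x} → 0# < x → 0# ≤ x ⁻¹
  0<x⇒0≤x⁻¹ {x} 0<x with total 0# (x ⁻¹)
  ... | inj₁ 0≤x⁻¹ = 0≤x⁻¹
  ... | inj₂ x⁻¹≤0 = contradiction 1≤0 (<⇒≱ 0<1)
    where
    1≤0 : 1# ≤ 0#
    1≤0 = ≤-respʳ-≈ (zeroʳ x) (≤-respˡ-≈ (*-inverseʳ x (>⇒≉0 0<x)) (*-monoˡ-≤ (<⇒≤ 0<x) x⁻¹≤0))

  x/y*y≈x : ∀ {x y} → y ≉ 0# → x / y * y ≈ x
  x/y*y≈x {x} {y} y≉0 = trans (*-assoc x (y ⁻¹) y)
    (trans (*-congˡ (trans (*-comm _ _) (*-inverseʳ y y≉0))) (*-identityʳ x))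

  0≤x/y : ∀ {x y} → 0# ≤ x → 0# < y → 0# ≤ x / y
  0≤x/y 0≤x 0<y = *-nonNegative 0≤x (0<x⇒0≤x⁻¹ 0<y)

  *-cancelʳ-≤ : ∀ {x y z} → 0# < z → x * z ≤ y * z → x ≤ y
  *-cancelʳ-≤ {x} {y} {z} 0<z p =
    ≤-respˡ-≈ (x*z/z≈x x) (≤-respʳ-≈ (x*z/z≈x y) (*-monoʳ-≤ (0<x⇒0≤x⁻¹ 0<z) p))
    where
    x*z/z≈x : ∀ x → x * z / z ≈ x
    x*z/z≈x x = trans (*-assoc x z (z ⁻¹)) (trans (*-congˡ (*-inverseʳ z (>⇒≉0 0<z))) (*-identityʳ x))

  *-cancelʳ-≈ : ∀ {x y z} → 0# < z → x * z ≈ y * z → x ≈ y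
  *-cancelʳ-≈ 0<z eq = antisym (*-cancelʳ-≤ 0<z (≤-reflexive eq))
                              (*-cancelʳ-≤ 0<z (≤-reflexive (sym eq)))

  ι⌊x⌋≤x : ∀ {x} → 0# ≤ x → ι ⌊ x ⌋ ≤ x
  ι⌊x⌋≤x {x} 0≤x = go (proj₁ (archimedean x))
    where
    go : ∀ n → ι (greatestUpTo n x) ≤ x
    go zero = 0≤x
    go (suc n) with ι (suc n) ≤? x
    ... | yes p = p
    ... | no  _ = go n

  -- The search for the floor starts at an Archimedean bound of `x` and steps down from `suc n` only
  -- when `x` lies below it, so `x` stays below the successor of the current candidate.
  x<ι[1+⌊x⌋] : ∀ x → x < ι (suc ⌊ x ⌋)
  x<ι[1+⌊x⌋] x = go n (≤-<-trans (proj₂ (archimedean x)) (ιn<ι[1+n] n))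
    where
    n = proj₁ (archimedean x)
    go : ∀ n → x < ι (suc n) → x < ι (suc (greatestUpTo n x))
    go zero    p = p
    go (suc n) p with ι (suc n) ≤? x
    ... | yes _ = p
    ... | no  q = go n (≰⇒> q)

  n≤⌊x⌋ : ∀ n {x} → ι n ≤ x → n ℕ.≤ ⌊ x ⌋
  n≤⌊x⌋ n {x} ιn≤x = ℕ.≤-pred (ι-cancel-< n (suc ⌊ x ⌋) (≤-<-trans ιn≤x (x<ι[1+⌊x⌋] x)))

  sum-mono-≤ : ∀ {n} {f g : Fin n → Carrier} → (∀ i → f i ≤ g i) → sum f ≤ sum g
  sum-mono-≤ {zero}  _ = ≤-refl
  sum-mono-≤ {suc n} p = +-mono-≤ (p zero) (sum-mono-≤ (p ∘ suc))

  sum-0 : ∀ {n} {f : Fin n → Carrier} → (∀ i → f i ≈ 0#) → sum f ≈ 0#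
  sum-0 {zero}  _ = refl
  sum-0 {suc n} p = trans (+-cong (p zero) (sum-0 (p ∘ suc))) (+-identityˡ 0#)

  -- Serves twice: a new item changes the term of its own type only, and, with `f` constantly 0, a
  -- sum with one non-zero term is evaluated.
  sum-bump : ∀ {n} {f g : Fin n → Carrier} {d} i → g i ≈ d + f i →
             (∀ j → j ≢ i → g j ≈ f j) → sum g ≈ d + sum f
  sum-bump zero p q =
    trans (+-cong p (sum-cong-≋ (λ j → q (suc j) λ ()))) (+-assoc _ _ _)
  sum-bump {f = f} {d = d} (suc i) p q =
    trans (+-cong (q zero λ ()) (sum-bump i p (λ j j≢i → q (suc j) (j≢i ∘ Fin.suc-injective))))
          (solve 3 (λ x y z → x :+ (y :+ z) := y :+ (x :+ z)) refl (f zero) d (sum (f ∘ suc)))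
    where open Solver

module Bound {c₀ ℓ₁ ℓ₂} (F : ArchimedeanOrderedField c₀ ℓ₁ ℓ₂) (P : Parameters F) where
  open ArchimedeanOrderedField F
  open OrderedFieldProperties F
  open Parameters P
  open SuperHarmonic F P

  -- The parameters: gaps, red groups and when they fit.

  monotone : ∀ {n ℓ} {_∼_ : Rel Carrier ℓ} → Reflexive _∼_ → Transitive _∼_ →
             (u : Fin (suc n) → Carrier) → (∀ i → u (inject₁ i) ∼ u (suc i)) →
             ∀ {i j} → toℕ i ℕ.≤ toℕ j → u i ∼ u j
  monotone                   ∼-refl ∼-trans u step {zero}  {zero}  _         = ∼-refl
  monotone {suc _} {_∼_ = _∼_} ∼-refl ∼-trans u step {zero}  {suc j} _         =
    ∼-trans (step zero) (monotone {_∼_ = _∼_} ∼-refl ∼-trans (u ∘ suc) (step ∘ suc) {zero} {j} z≤n)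
  monotone {suc _} {_∼_ = _∼_} ∼-refl ∼-trans u step {suc i} {suc j} (s≤s i≤j) =
    monotone {_∼_ = _∼_} ∼-refl ∼-trans (u ∘ suc) (step ∘ suc) i≤j

  Δ-mono : ∀ {i j} → toℕ i ℕ.≤ toℕ j → Δ i ≤ Δ j
  Δ-mono = monotone {_∼_ = _≤_} ≤-refl ≤-trans Δ (λ j → <⇒≤ (Δ-incr j))

  t-anti : ∀ {i j} → toℕ i ℕ.≤ toℕ j → t j ≤ t i
  t-anti = monotone {_∼_ = flip _≤_} ≤-refl (flip ≤-trans) t (λ i → <⇒≤ (t-decr i))

  0<τ : ∀ i → 0# < τ i
  0<τ i = ≤-<-trans (≤-respˡ-≈ t-last (t-anti (Fin.≤fromℕ (suc (inject₁ i))))) (t-decr (inject₁ i))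

  τ≤1 : ∀ i → τ i ≤ 1#
  τ≤1 i = ≤-respʳ-≈ t-head (t-anti z≤n)

  ε<1 : ε < 1#
  -- Since `1 ≤ k`, the index of `ε` is at least 1, so `ε` is at most the second entry of `t`, which
  -- is below the first.
  ε<1 = ≤-<-trans (t-anti 1≤) (<-≤-trans (t-decr zero) (≤-reflexive t-head))
    where
    1≤ : 1 ℕ.≤ toℕ (inject₁ (fromℕ k))
    1≤ = ≡.subst (1 ℕ.≤_) (≡.sym (≡.trans (Fin.toℕ-inject₁ (fromℕ k)) (Fin.toℕ-fromℕ k))) 1≤k

  0<1-ε : 0# < 1# - ε
  0<1-ε = 0≤y-x (<⇒≤ ε<1) , λ eq →
    proj₂ ε<1 (trans (sym (+-identityˡ ε)) (trans (+-congʳ eq) (x-y+y≈x 1# ε)))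

  β≢0 : ∀ i → β i ≢ 0
  β≢0 i = ℕ.m<n⇒n≢0 (n≤⌊x⌋ 1 (*-cancelʳ-≤ (0<τ i) (begin
    ι 1 * τ i       ≈⟨ *-congʳ ι1≈1 ⟩
    1# * τ i        ≈⟨ *-identityˡ (τ i) ⟩
    τ i             ≤⟨ τ≤1 i ⟩
    1#              ≈⟨ x/y*y≈x (>⇒≉0 (0<τ i)) ⟨
    1# / τ i * τ i  ∎)))
    where open ≤-Reasoning

  -- `δ i` is the room left beside `β i` items of size `τ i`; if one more fitted, `β i + 1` would be
  -- at most `1 / τ i`, against the choice of `β i` as its floor.
  τ≰δ : ∀ i → ¬ (τ i ≤ δ i)
  τ≰δ i τ≤δ = <⇒≱ (x<ι[1+⌊x⌋] (1# / τ i)) (*-cancelʳ-≤ (0<τ i) (begin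
    (1# + ι (β i)) * τ i
      ≈⟨ solve 2 (λ b τ → (con 1 :+ b) :* τ := τ :+ τ :* b) refl (ι (β i)) (τ i) ⟩
    τ i + τ i * ι (β i)      ≤⟨ +-monoˡ-≤ (τ i * ι (β i)) τ≤δ ⟩
    δ i + τ i * ι (β i)      ≈⟨ x-y+y≈x 1# (τ i * ι (β i)) ⟩
    1#                       ≈⟨ x/y*y≈x (>⇒≉0 (0<τ i)) ⟨
    1# / τ i * τ i           ∎))
    where
    open ≤-Reasoning
    open Solver

  γ≢0⇒τ≤Δ : ∀ i → γ i ≢ 0 → τ i ≤ Δ (fromℕ K)
  γ≢0⇒τ≤Δ i γ≢0 with τ i ≤? Δ (fromℕ K)
  ... | yes p = p
  ... | no  _ = contradiction ≡.refl γ≢0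

  -- Where `τ i ≤ Δ (fromℕ K)`, `γ i` is a maximum with 1; so `γ i = 0` leaves only the case
  -- governed by `α-zero`.
  γ≡0⇒α≈0 : ∀ i → γ i ≡ 0 → α i ≈ 0#
  γ≡0⇒α≈0 i γ≡0 with τ i ≤? Δ (fromℕ K)
  ... | yes _ = contradiction γ≡0 (ℕ.m<n⇒n≢0 (ℕ.m≤m⊔n 1 ⌊ at1 Δ / τ i ⌋))
  ... | no  p = α-zero i (≰⇒> p)

  Fits : Fin k → Fin k → Set _
  Fits i j = ι (γ j) * τ j ≤ Δ (φ i)

  fits⇒≢ : ∀ i j → γ j ≢ 0 → Fits i j → i ≢ j
  fits⇒≢ i .i γ≢0 fit ≡.refl = τ≰δ i (begin
    τ i            ≈⟨ *-identityˡ (τ i) ⟨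
    1# * τ i       ≤⟨ *-monoʳ-≤ (<⇒≤ (0<τ i)) (1≤ι (γ i) γ≢0) ⟩
    ι (γ i) * τ i  ≤⟨ fit ⟩
    Δ (φ i)        ≤⟨ Δφ≤δ i ⟩
    δ i            ∎)
    where open ≤-Reasoning

  at1≤ : ∀ {n} (u : Fin (suc n) → Carrier) → (∀ {i j} → toℕ i ℕ.≤ toℕ j → u i ≤ u j) →
         ∀ {m} → m ≢ zero → at1 u ≤ u m
  at1≤ {_}     u mono {zero}  m≢0 = contradiction ≡.refl m≢0
  at1≤ {suc _} u mono {suc m} _   = mono (s≤s z≤n)

  0≤at1Δ : 0# ≤ at1 Δ
  0≤at1Δ = ≤-respˡ-≈ Δ-head (head≤ Δ Δ-mono)
    where
    head≤ : ∀ {n} (u : Fin (suc n) → Carrier) → (∀ {i j} → toℕ i ℕ.≤ toℕ j → u i ≤ u j) →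
            u zero ≤ at1 u
    head≤ {zero}  u _    = ≤-refl
    head≤ {suc _} u mono = mono z≤n

  -- A whole red group fits wherever a single item does: a group of at most one item needs only
  -- `τ j ≤ Δ m`, and otherwise `γ j` is the floor of Δ₁ / `τ j`, so the group fits already in Δ₁,
  -- which is at most `Δ m`.
  γτ≤Δ : ∀ j {m} → m ≢ zero → τ j ≤ Δ m → ι (γ j) * τ j ≤ Δ m
  γτ≤Δ j {m} m≢0 τ≤Δm with τ j ≤? Δ (fromℕ K)
  ... | no  _ = ≤-respˡ-≈ (sym (zeroˡ (τ j))) (≤-trans (<⇒≤ (0<τ j)) τ≤Δm)
  ... | yes _ with ℕ.⊔-sel 1 ⌊ at1 Δ / τ j ⌋
  ...   | inj₁ eq rewrite eq = ≤-respˡ-≈ (sym (trans (*-congʳ ι1≈1) (*-identityˡ (τ j)))) τ≤Δm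
  ...   | inj₂ eq rewrite eq = begin
    ι ⌊ at1 Δ / τ j ⌋ * τ j  ≤⟨ *-monoʳ-≤ (<⇒≤ (0<τ j)) (ι⌊x⌋≤x (0≤x/y 0≤at1Δ (0<τ j))) ⟩
    at1 Δ / τ j * τ j        ≈⟨ x/y*y≈x (>⇒≉0 (0<τ j)) ⟩
    at1 Δ                    ≤⟨ at1≤ Δ Δ-mono m≢0 ⟩
    Δ m                      ∎
    where open ≤-Reasoning

  varphi-spec : ∀ j → γ j ≢ 0 → varphi j ≢ zero × τ j ≤ Δ (varphi j)
  varphi-spec j γ≢0 with found (map⁺ (Any.map (λ { ≡.refl → proj₂ witness }) (∈-allFin (proj₁ witness))))
    where
    witness : ∃ λ m → τ j ≤ Δ (suc m)
    -- The last index satisfies the searched property. It is not 0, because `Δ zero` is 0 and `τ j`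
    -- is positive, so it lies in the searched list.
    witness with fromℕ K | γ≢0⇒τ≤Δ j γ≢0
    ... | zero  | τ≤Δ = contradiction (≤-respʳ-≈ Δ-head τ≤Δ) (<⇒≱ (0<τ j))
    ... | suc m | τ≤Δ = m , τ≤Δ

    found : ∀ {xs} → Any (λ m → τ j ≤ Δ m) xs →
            τ j ≤ Δ (fromMaybe zero (find (λ m → τ j ≤? Δ m) xs)) ×
            fromMaybe zero (find (λ m → τ j ≤? Δ m) xs) ∈ xs
    found {x ∷ xs} any with τ j ≤? Δ x
    found {x ∷ xs} any         | yes p = p , here ≡.refl
    found {x ∷ xs} (here p)    | no ¬p = contradiction p ¬p
    found {x ∷ xs} (there any) | no ¬p = proj₁ (found any) , there (proj₂ (found any))
  ... | τ≤Δ , m∈ with ∈-map⁻ suc m∈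
  -- The result is a member of the searched list, which holds successors only; hence it is not the
  -- default 0.
  ...   | _ , _ , eq = (λ eq′ → case ≡.trans (≡.sym eq′) eq of λ ()) , τ≤Δ

  -- If `varphi j ≤ φ i`, then `τ j ≤ Δ (φ i)` by monotonicity of `Δ`, and `γτ≤Δ` extends this to
  -- the whole red group. This turns the absence of matching pairs into the threshold that separates
  -- pure blue from pure red bins.
  ¬fits⇒φ<varphi : ∀ i j → γ j ≢ 0 → ¬ Fits i j → toℕ (φ i) ℕ.< toℕ (varphi j)
  ¬fits⇒φ<varphi i j γ≢0 ¬fits with varphi-spec j γ≢0
  ... | v≢0 , τ≤Δ = ℕ.≰⇒> (λ v≤φ → ¬fits (γτ≤Δ j
    (λ φ≡0 → v≢0 (Fin.toℕ-injective (ℕ.n≤0⇒n≡0 (≡.subst (λ m → _ ℕ.≤ toℕ m) φ≡0 v≤φ))))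
    (≤-trans τ≤Δ (Δ-mono v≤φ))))

  -- Bins by colour and type, and sums over them.

  data Colour : Set where
    blue red : Colour

  opposite : Colour → Colour
  opposite blue = red
  opposite red  = blue

  typeOf : Colour → Group → Maybe (Fin k)
  typeOf blue (only i)    = just i
  typeOf blue (blue? i)   = just i
  typeOf blue (red? j)    = nothing
  typeOf blue (mixed i j) = just i
  typeOf red  (only i)    = nothing
  typeOf red  (blue? i)   = nothing
  typeOf red  (red? j)    = just j
  typeOf red  (mixed i j) = just j

  capacity : Colour → Fin k → ℕ
  capacity blue = β
  capacity red  = γ

  GoodGroup : Group → Set
  GoodGroup (only i)    = φ i ≡ zero
  GoodGroup (blue? i)   = φ i ≢ zero
  GoodGroup (red? j)    = γ j ≢ 0
  GoodGroup (mixed i j) = φ i ≢ zero × γ j ≢ 0 × i ≢ j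

  -- The second component is needed when a bin is renamed: its new colour must start from count 0,
  -- or the tally would rise by more than one.
  Good : Bin → Set
  Good b = GoodGroup (group b) × (∀ i → (∀ c → typeOf c (group b) ≢ just i) → count i b ≡ 0)

  -- Since γ τ ≤ Δ φ ≤ δ < τ cannot hold for a single type, no bin (i,i) arises; hence
  -- count i b counts the items of one colour only.
  distinct : ∀ c g {i} → GoodGroup g → typeOf c g ≡ just i → typeOf (opposite c) g ≢ just i
  distinct blue (only _)    _               _      ()
  distinct blue (blue? _)   _               _      ()
  distinct blue (mixed i j) (_ , _ , i≢j)   ≡.refl eq = i≢j (≡.sym (just-injective eq))
  distinct red  (red? _)    _               _      ()
  distinct red  (mixed i j) (_ , _ , i≢j)   ≡.refl eq = i≢j (just-injective eq)

  red⇒γ≢0 : ∀ {j} g → GoodGroup g → typeOf red g ≡ just j → γ j ≢ 0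
  red⇒γ≢0 (red? _)    γ≢0           ≡.refl = γ≢0
  red⇒γ≢0 (mixed _ _) (_ , γ≢0 , _) ≡.refl = γ≢0

  count-∷-≡ : ∀ {i p} xs → type p ≡ inject₁ i → ∀ {g g′} →
              count i (bin g (p ∷ xs)) ≡ suc (count i (bin g′ xs))
  count-∷-≡ {i} xs eq = ≡.cong length (filter-accept (λ q → type q Fin.≟ inject₁ i) {xs = xs} eq)

  count-∷-≢ : ∀ {i j p} xs → type p ≡ inject₁ i → j ≢ i → ∀ {g g′} →
              count j (bin g (p ∷ xs)) ≡ count j (bin g′ xs)
  count-∷-≢ {i} {j} xs eq j≢i = ≡.cong length (filter-reject (λ q → type q Fin.≟ inject₁ j) {xs = xs}
    (λ eq′ → j≢i (Fin.inject₁-injective (≡.trans (≡.sym eq′) eq))))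

  just≢just : ∀ {m : Maybe (Fin k)} {i j} → j ≢ i → m ≡ just i → m ≢ just j
  just≢just j≢i ≡.refl eq = j≢i (≡.sym (just-injective eq))

  nothing≢just : ∀ {m : Maybe (Fin k)} {i} → m ≡ nothing → m ≢ just i
  nothing≢just ≡.refl ()

  occupied? : (m : Maybe (Fin k)) (i : Fin k) → Dec (m ≡ just i)
  occupied? m i = ≡-dec Fin._≟_ m (just i)

  valueIf : (ℕ → ℕ) → Fin k → Maybe (Fin k) → ℕ → ℕ
  valueIf f i m n = if does (occupied? m i) then f n else 0

  valueIf-≡ : ∀ f {i m} n → m ≡ just i → valueIf f i m n ≡ f n
  valueIf-≡ f {i} {m} n eq rewrite dec-true (occupied? m i) eq = ≡.refl

  valueIf-≢ : ∀ f {i m} n → m ≢ just i → valueIf f i m n ≡ 0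
  valueIf-≢ f {i} {m} n neq rewrite dec-false (occupied? m i) neq = ≡.refl

  -- The free `f` lets one set of update lemmas serve three sums: `id` tallies items,
  -- `capacity c i ∸_` gives the deficit, `const 1` counts bins.
  slot : Colour → Fin k → (ℕ → ℕ) → Bin → ℕ
  slot c i f b = valueIf f i (typeOf c (group b)) (count i b)

  slotSum : Colour → Fin k → (ℕ → ℕ) → List Bin → ℕ
  slotSum c i f B = ℕ.sum (List.map (slot c i f) B)

  -- The old value is added on the left instead of being subtracted on the right, which avoids
  -- truncated subtraction.
  sum-map-∷= : (f : Bin → ℕ) → ∀ {b B} (b∈ : b ∈ B) b′ →
               ℕ.sum (List.map f (b∈ ∷= b′)) ℕ.+ f b ≡ ℕ.sum (List.map f B) ℕ.+ f b′
  sum-map-∷= f {b} {_ ∷ B} (here ≡.refl) b′ =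
    ℕSolver.solve 3 (λ x y z → ((x :+ z) :+ y) := ((y :+ z) :+ x)) ≡.refl
      (f b′) (f b) (ℕ.sum (List.map f B))
    where open ℕSolver
  sum-map-∷= f {b} {x ∷ B} (there b∈) b′ = begin
    f x ℕ.+ ℕ.sum (List.map f (b∈ ∷= b′)) ℕ.+ f b    ≡⟨ ℕ.+-assoc (f x) _ _ ⟩
    f x ℕ.+ (ℕ.sum (List.map f (b∈ ∷= b′)) ℕ.+ f b)  ≡⟨ ≡.cong (f x ℕ.+_) (sum-map-∷= f b∈ b′) ⟩
    f x ℕ.+ (ℕ.sum (List.map f B) ℕ.+ f b′)          ≡⟨ ℕ.+-assoc (f x) _ _ ⟨
    f x ℕ.+ ℕ.sum (List.map f B) ℕ.+ f b′            ∎
    where open ≡.≡-Reasoning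

  sum-∷=-≡ : (f : Bin → ℕ) → ∀ {b b′ B} (b∈ : b ∈ B) → f b′ ≡ f b →
             ℕ.sum (List.map f (b∈ ∷= b′)) ≡ ℕ.sum (List.map f B)
  sum-∷=-≡ f {b} {b′} {B} b∈ eq = ℕ.+-cancelʳ-≡ (f b) _ _
    (≡.trans (sum-map-∷= f b∈ b′) (≡.cong (ℕ.sum (List.map f B) ℕ.+_) eq))

  All-∷= : ∀ {p} {Q : Bin → Set p} {b b′ B} (b∈ : b ∈ B) → All Q B → Q b′ → All Q (b∈ ∷= b′)
  All-∷= (here _)   (_ ∷ qs) q′ = q′ ∷ qs
  All-∷= (there b∈) (q ∷ qs) q′ = q ∷ All-∷= b∈ qs q′

  Any-∷=⁻ : ∀ {p} {Q : Bin → Set p} {b b′ B} (b∈ : b ∈ B) → (Q b′ → Q b) → Any Q (b∈ ∷= b′) → Any Q B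
  Any-∷=⁻ (here ≡.refl) f (here q)   = here (f q)
  Any-∷=⁻ (here ≡.refl) f (there qs) = there qs
  Any-∷=⁻ (there b∈)    f (here q)   = here q
  Any-∷=⁻ (there b∈)    f (there qs) = there (Any-∷=⁻ b∈ f qs)

  -- One coloured placement and its effect on the sums.

  Partial : Colour → Fin k → Bin → Set
  Partial c i b = typeOf c (group b) ≡ just i × count i b ℕ.< capacity c i

  record Gain (c : Colour) (i : Fin k) (p : Item) (b b′ : Bin) : Set (c₀ ⊔ ℓ₁ ⊔ ℓ₂) where
    constructor gain
    field
      items≡ : items b′ ≡ p ∷ items b
      gained : typeOf c (group b′) ≡ just i
      kept   : typeOf (opposite c) (group b′) ≡ typeOf (opposite c) (group b)
      good   : GoodGroup (group b′)

  -- The common shape of all placement rules, red and blue. Only `match` and `new` record that no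
  -- partial bin existed: they alone begin a group of colour `c`, whereas `topUp` cannot increase a
  -- deficit.
  data Fill (c : Colour) (i : Fin k) (p : Item) (B : List Bin) : List Bin → Set (c₀ ⊔ ℓ₁ ⊔ ℓ₂) where
    topUp : ∀ {b b′} (b∈ : b ∈ B) → Gain c i p b b′ → Partial c i b → Fill c i p B (b∈ ∷= b′)
    match : ¬ Any (Partial c i) B → ∀ {b b′} (b∈ : b ∈ B) → Gain c i p b b′ →
            typeOf c (group b) ≡ nothing → Fill c i p B (b∈ ∷= b′)
    new   : ¬ Any (Partial c i) B → ∀ {g} → typeOf c g ≡ just i → typeOf (opposite c) g ≡ nothing →
            GoodGroup g → Fill c i p B (bin g (p ∷ []) ∷ B)

  -- The deficit Σ (capacity ∸ count) over the bins of a class replaces the usual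
  -- "all but one of the bins are full": it never exceeds the capacity.
  noPartial⇒noDeficit : ∀ {c i} B → ¬ Any (Partial c i) B → slotSum c i (capacity c i ∸_) B ≡ 0
  noPartial⇒noDeficit []      _  = ≡.refl
  noPartial⇒noDeficit {c} {i} (b ∷ B) ¬p =
    ≡.cong₂ ℕ._+_ head≡0 (noPartial⇒noDeficit B (¬p ∘ there))
    where
    head≡0 : slot c i (capacity c i ∸_) b ≡ 0
    head≡0 with occupied? (typeOf c (group b)) i
    ... | no  _  = ≡.refl
    ... | yes eq = ℕ.m≤n⇒m∸n≡0 (ℕ.≮⇒≥ (λ lt → ¬p (here (eq , lt))))

  module _ {c : Colour} {i : Fin k} {p : Item} (type≡ : type p ≡ inject₁ i) where

    gain-count-≡ : ∀ {b b′} → Gain c i p b b′ → count i b′ ≡ suc (count i b)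
    gain-count-≡ {b} {bin _ _} (gain ≡.refl _ _ _) = count-∷-≡ (items b) type≡ {group b} {group b}

    gain-count-≢ : ∀ {b b′ j} → Gain c i p b b′ → j ≢ i → count j b′ ≡ count j b
    gain-count-≢ {b} {bin _ _} (gain ≡.refl _ _ _) j≢i =
      count-∷-≢ (items b) type≡ j≢i {group b} {group b}

    gain-slot-≡ : ∀ {b b′} → Gain c i p b b′ → ∀ f → slot c i f b′ ≡ f (suc (count i b))
    gain-slot-≡ {b} {b′} gn f =
      ≡.trans (valueIf-≡ f (count i b′) (Gain.gained gn)) (≡.cong f (gain-count-≡ gn))

    -- Only the count of type `i` changes, and by `distinct` the opposite colour of this bin is not
    -- of type `i`, neither before nor after.
    gain-slot-opposite : ∀ {b b′} → Gain c i p b b′ → ∀ j f →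
                         slot (opposite c) j f b′ ≡ slot (opposite c) j f b
    gain-slot-opposite {b} {b′} gn j f with j Fin.≟ i
    ... | no  j≢i    = ≡.cong₂ (valueIf f j) (Gain.kept gn) (gain-count-≢ gn j≢i)
    ... | yes ≡.refl = ≡.trans (valueIf-≢ f (count i b′) ≢just)
      (≡.sym (valueIf-≢ f (count i b) (≢just ∘ ≡.trans (Gain.kept gn))))
      where
      ≢just : typeOf (opposite c) (group b′) ≢ just i
      ≢just = distinct c (group b′) (Gain.good gn) (Gain.gained gn)

    gain-slot-≢ : ∀ {b b′ j} → Gain c i p b b′ → typeOf c (group b) ≢ just j → j ≢ i → ∀ f →
                  slot c j f b′ ≡ slot c j f b
    gain-slot-≢ {b} {b′} {j} gn b≢j j≢i f =
      ≡.trans (valueIf-≢ f (count j b′) (just≢just j≢i (Gain.gained gn)))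
              (≡.sym (valueIf-≢ f (count j b) b≢j))

    fill-opposite : ∀ {B B′} → Fill c i p B B′ → ∀ j f →
                    slotSum (opposite c) j f B′ ≡ slotSum (opposite c) j f B
    fill-opposite (topUp b∈ gn _) j f = sum-∷=-≡ (slot (opposite c) j f) b∈ (gain-slot-opposite gn j f)
    fill-opposite (match _ b∈ gn _) j f = sum-∷=-≡ (slot (opposite c) j f) b∈ (gain-slot-opposite gn j f)
    fill-opposite {B} (new _ {g} _ eq _) j f = ≡.cong (ℕ._+ slotSum (opposite c) j f B)
      (valueIf-≢ f (count j (bin g (p ∷ []))) (nothing≢just eq))

    fill-≢ : ∀ {B B′} → Fill c i p B B′ → ∀ {j} → j ≢ i → ∀ f →
             slotSum c j f B′ ≡ slotSum c j f B
    fill-≢ (topUp b∈ gn (eq , _)) {j} j≢i f =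
      sum-∷=-≡ (slot c j f) b∈ (gain-slot-≢ gn (just≢just j≢i eq) j≢i f)
    fill-≢ (match _ b∈ gn eq) {j} j≢i f =
      sum-∷=-≡ (slot c j f) b∈ (gain-slot-≢ gn (nothing≢just eq) j≢i f)
    fill-≢ {B} (new _ {g} eq _ _) {j} j≢i f = ≡.cong (ℕ._+ slotSum c j f B)
      (valueIf-≢ f (count j (bin g (p ∷ []))) (just≢just j≢i eq))

    count-new : ∀ g → count i (bin g (p ∷ [])) ≡ 1
    count-new g = count-∷-≡ [] type≡ {g} {g}

    -- Neither colour of the bin is of type `i` before the gain: colour `c` is vacant, and the
    -- opposite one is kept, hence excluded by `distinct`.
    gain-empty : ∀ {b b′} → Gain c i p b b′ → Good b → typeOf c (group b) ≡ nothing → count i b ≡ 0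
    gain-empty {b} {b′} gn good eq = proj₂ good i λ c′ → absent c′ c ≡.refl
      where
      opp≢ = λ eq′ → distinct c (group b′) (Gain.good gn) (Gain.gained gn) (≡.trans (Gain.kept gn) eq′)
      c≢ : typeOf c (group b) ≢ just i
      c≢ = nothing≢just eq
      -- `c` is fixed by the enclosing module; the copy `d` makes it available for case analysis.
      absent : ∀ c′ d → d ≡ c → typeOf c′ (group b) ≢ just i
      absent blue blue ≡.refl = c≢
      absent blue red  ≡.refl = opp≢
      absent red  blue ≡.refl = opp≢
      absent red  red  ≡.refl = c≢

    fill-tally : ∀ {B B′} → All Good B → Fill c i p B B′ →
                 slotSum c i id B′ ≡ suc (slotSum c i id B)
    fill-tally {B} good (topUp {b} {b′} b∈ gn (eq , _)) = ℕ.+-cancelʳ-≡ (slot c i id b) _ _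
      (≡.trans (sum-map-∷= (slot c i id) b∈ b′)
        (≡.trans (≡.cong (slotSum c i id B ℕ.+_)
            (≡.trans (gain-slot-≡ gn id) (≡.cong suc (≡.sym (valueIf-≡ id (count i b) eq)))))
          (ℕ.+-suc (slotSum c i id B) _)))
    fill-tally {B} good (match _ {b} {b′} b∈ gn eq) = ℕ.+-cancelʳ-≡ (slot c i id b) _ _
      (≡.trans (sum-map-∷= (slot c i id) b∈ b′)
        (≡.trans (≡.cong (slotSum c i id B ℕ.+_)
            (≡.trans (gain-slot-≡ gn id) (≡.cong suc (≡.trans (gain-empty gn (All.lookup good b∈) eq)
              (≡.sym (valueIf-≢ id (count i b) (nothing≢just eq)))))))
          (ℕ.+-suc (slotSum c i id B) _)))
    fill-tally {B} good (new _ {g} eq _ _) = ≡.cong (ℕ._+ slotSum c i id B)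
      (≡.trans (valueIf-≡ id (count i (bin g (p ∷ []))) eq) (count-new g))

    -- Topping up cannot raise the deficit. The other two cases start from deficit 0, since no
    -- partial bin existed, and then the one newly started group misses at most a full capacity.
    fill-deficit : ∀ {B B′} → All Good B → Fill c i p B B′ →
                   slotSum c i (capacity c i ∸_) B ℕ.≤ capacity c i →
                   slotSum c i (capacity c i ∸_) B′ ℕ.≤ capacity c i
    fill-deficit {B} good (topUp {b} {b′} b∈ gn (eq , _)) D≤ =
      ℕ.≤-trans (ℕ.+-cancelʳ-≤ (slot c i (capacity c i ∸_) b) _ _ (begin
        slotSum c i f (b∈ ∷= b′) ℕ.+ slot c i f b  ≡⟨ sum-map-∷= (slot c i f) b∈ b′ ⟩
        slotSum c i f B ℕ.+ slot c i f b′
          ≡⟨ ≡.cong (slotSum c i f B ℕ.+_) (gain-slot-≡ gn f) ⟩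
        slotSum c i f B ℕ.+ f (suc (count i b))
          ≤⟨ ℕ.+-monoʳ-≤ (slotSum c i f B) (ℕ.∸-monoʳ-≤ (capacity c i) (ℕ.n≤1+n _)) ⟩
        slotSum c i f B ℕ.+ f (count i b)
          ≡⟨ ≡.cong (slotSum c i f B ℕ.+_) (valueIf-≡ f (count i b) eq) ⟨
        slotSum c i f B ℕ.+ slot c i f b           ∎)) D≤
      where
      f = capacity c i ∸_
      open ℕ.≤-Reasoning
    fill-deficit {B} good (match ¬p {b} {b′} b∈ gn eq) D≤ =
      ℕ.+-cancelʳ-≤ (slot c i (capacity c i ∸_) b) _ _ (begin
        slotSum c i f (b∈ ∷= b′) ℕ.+ slot c i f b  ≡⟨ sum-map-∷= (slot c i f) b∈ b′ ⟩
        slotSum c i f B ℕ.+ slot c i f b′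
          ≡⟨ ≡.cong (ℕ._+ slot c i f b′) (noPartial⇒noDeficit B ¬p) ⟩
        slot c i f b′                              ≡⟨ gain-slot-≡ gn f ⟩
        f (suc (count i b))                        ≤⟨ ℕ.m∸n≤m (capacity c i) (suc (count i b)) ⟩
        capacity c i                               ≤⟨ ℕ.m≤m+n _ _ ⟩
        capacity c i ℕ.+ slot c i f b              ∎)
      where
      f = capacity c i ∸_
      open ℕ.≤-Reasoning
    fill-deficit {B} good (new ¬p {g} eq _ _) D≤ = begin
        slot c i f (bin g (p ∷ [])) ℕ.+ slotSum c i f B
          ≡⟨ ≡.cong₂ ℕ._+_ (valueIf-≡ f (count i (bin g (p ∷ []))) eq) (noPartial⇒noDeficit B ¬p) ⟩
        f (count i (bin g (p ∷ []))) ℕ.+ 0               ≡⟨ ℕ.+-identityʳ _ ⟩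
        f (count i (bin g (p ∷ [])))
          ≤⟨ ℕ.m∸n≤m (capacity c i) (count i (bin g (p ∷ []))) ⟩
        capacity c i                                     ∎
      where
      f = capacity c i ∸_
      open ℕ.≤-Reasoning

    gain-good : ∀ {b b′} → Gain c i p b b′ → (∀ {j} → j ≢ i → typeOf c (group b) ≢ just j) →
                Good b → Good b′
    gain-good {b} {b′} gn before (_ , unused) = Gain.good gn , λ j absent →
      let j≢i = λ { ≡.refl → absent c (Gain.gained gn) } in
      ≡.trans (gain-count-≢ gn j≢i) (unused j (λ c′ → absent-before absent (before j≢i) c′ c ≡.refl))
      where
      absent-before : ∀ {j} → (∀ c′ → typeOf c′ (group b′) ≢ just j) → typeOf c (group b) ≢ just j →
                      ∀ c′ d → d ≡ c → typeOf c′ (group b) ≢ just j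
      absent-before absent h blue blue ≡.refl = h
      absent-before absent h red  red  ≡.refl = h
      absent-before absent h blue red  ≡.refl = absent blue ∘ ≡.trans (Gain.kept gn)
      absent-before absent h red  blue ≡.refl = absent red ∘ ≡.trans (Gain.kept gn)

    fill-good : ∀ {B B′} → Fill c i p B B′ → All Good B → All Good B′
    fill-good (topUp b∈ gn (eq , _)) goods = All-∷= b∈ goods
      (gain-good gn (λ j≢i → just≢just j≢i eq) (All.lookup goods b∈))
    fill-good (match _ b∈ gn eq) goods = All-∷= b∈ goods
      (gain-good gn (λ _ → nothing≢just eq) (All.lookup goods b∈))
    fill-good (new _ {g} eq _ good) goods =
      (good , λ j absent → count-∷-≢ [] type≡ (λ { ≡.refl → absent c eq }) {g} {g}) ∷ goods

  -- The placement rules as fills, and the absence of matching pairs.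

  NoMatch : List Bin → Set _
  NoMatch B = ∀ i j → Any (λ b → group b ≡ blue? i) B → Any (λ b → group b ≡ red? j) B → ¬ Fits i j

  noPartial : ∀ {c i B q} {Q : Bin → Set q} → All Good B → (∀ b → Good b → Partial c i b → Q b) →
              ¬ Any Q B → ¬ Any (Partial c i) B
  noPartial (good ∷ _) imp ¬q (here q)    = ¬q (here (imp _ good q))
  noPartial (_ ∷ goods) imp ¬q (there any) = noPartial goods imp (¬q ∘ there) any

  red-partial : ∀ {i} b → Good b → Partial red i b → RedPure i b ⊎ RedMixed i b
  red-partial (bin (red? _) _)    _ (≡.refl , lt) = inj₁ (≡.refl , lt)
  red-partial (bin (mixed j _) _) _ (≡.refl , lt) = inj₂ ((j , ≡.refl) , lt)

  -- `Partial blue` does not see the kind of group, but `GoodGroup` determines whether `φ i` is 0,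
  -- which leaves exactly the kinds that the algorithm inspects.
  blue-partial : ∀ {i} → φ i ≢ zero → ∀ b → Good b → Partial blue i b → BluePartial i b
  blue-partial φ≢0 (bin (only _) _)    (φ≡0 , _) (≡.refl , lt) = contradiction φ≡0 φ≢0
  blue-partial _   (bin (blue? _) _)   _         (≡.refl , lt) = inj₂ ≡.refl , lt
  blue-partial _   (bin (mixed _ j) _) _         (≡.refl , lt) = inj₁ (j , ≡.refl) , lt

  only-partial : ∀ {i} → φ i ≡ zero → ∀ b → Good b → Partial blue i b → OnlyPartial i b
  only-partial _   (bin (only _) _)    _               (≡.refl , lt) = ≡.refl , lt
  only-partial φ≡0 (bin (blue? _) _)   (φ≢0 , _)       (≡.refl , lt) = contradiction φ≡0 φ≢0
  only-partial φ≡0 (bin (mixed _ _) _) ((φ≢0 , _) , _) (≡.refl , lt) = contradiction φ≡0 φ≢0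

  goodGroup : ∀ {b g B} → All Good B → b ∈ B → group b ≡ g → GoodGroup g
  goodGroup goods b∈ ≡.refl = proj₁ (All.lookup goods b∈)

  placeRed⇒fill : ∀ {i p B B′} → γ i ≢ 0 → All Good B → PlaceRed i p B B′ → Fill red i p B B′
  placeRed⇒fill {i} γ≢0 goods = λ where
      (pure b∈ (eq , lt)) →
        topUp b∈ (gain ≡.refl (≡.cong (typeOf red) eq) ≡.refl (proj₁ (All.lookup goods b∈)))
                 (≡.cong (typeOf red) eq , lt)
      (mixed _ b∈ ((j , eq) , lt)) →
        topUp b∈ (gain ≡.refl (≡.cong (typeOf red) eq) ≡.refl (proj₁ (All.lookup goods b∈)))
                 (≡.cong (typeOf red) eq , lt)
      (match ¬p ¬m b∈ (j , eq , fit)) →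
        match (none ¬p ¬m) b∈
          (gain ≡.refl ≡.refl (≡.sym (≡.cong (typeOf blue) eq))
            (goodGroup goods b∈ eq , γ≢0 , fits⇒≢ j i γ≢0 fit))
          (≡.cong (typeOf red) eq)
      (new ¬p ¬m _) → new (none ¬p ¬m) ≡.refl ≡.refl γ≢0
    where
    none : ¬ Any (RedPure i) _ → ¬ Any (RedMixed i) _ → ¬ Any (Partial red i) _
    none ¬p ¬m = noPartial goods red-partial (λ any → case Any-⊎⁻ any of λ where
      (inj₁ p) → ¬p p
      (inj₂ m) → ¬m m)

  -- Adding to a bin keeps its group, and a match turns a pure bin into a mixed one, so neither
  -- creates a pair. Only a new pure red bin could, and it is opened when no blue partner fits.
  placeRed-noMatch : ∀ {i p B B′} → PlaceRed i p B B′ → NoMatch B → NoMatch B′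
  placeRed-noMatch (pure b∈ _)      nm i j x y = nm i j (Any-∷=⁻ b∈ id x) (Any-∷=⁻ b∈ id y)
  placeRed-noMatch (mixed _ b∈ _)   nm i j x y = nm i j (Any-∷=⁻ b∈ id x) (Any-∷=⁻ b∈ id y)
  placeRed-noMatch (match _ _ b∈ _) nm i j x y = nm i j (Any-∷=⁻ b∈ (λ ()) x) (Any-∷=⁻ b∈ (λ ()) y)
  placeRed-noMatch (new _ _ ¬match) nm i j (there x) (here ≡.refl) fit =
    ¬match (Any.map (λ eq → i , eq , fit) x)
  placeRed-noMatch (new _ _ ¬match) nm i j (there x) (there y)     = nm i j x y

  placeBlue⇒fill : ∀ {i p B B′} → All Good B → PlaceBlue i p B B′ → Fill blue i p B B′
  placeBlue⇒fill {i} goods = λ where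
    (only _ b∈ (eq , lt)) →
      topUp b∈ (gain ≡.refl (≡.cong (typeOf blue) eq) ≡.refl (proj₁ (All.lookup goods b∈)))
               (≡.cong (typeOf blue) eq , lt)
    (newOnly φ≡0 ¬p) → new (noPartial goods (only-partial φ≡0) ¬p) ≡.refl ≡.refl φ≡0
    (partial _ b∈ (inj₁ (j , eq) , lt)) →
      topUp b∈ (gain ≡.refl (≡.cong (typeOf blue) eq) ≡.refl (proj₁ (All.lookup goods b∈)))
               (≡.cong (typeOf blue) eq , lt)
    (partial _ b∈ (inj₂ eq , lt)) →
      topUp b∈ (gain ≡.refl (≡.cong (typeOf blue) eq) ≡.refl (proj₁ (All.lookup goods b∈)))
               (≡.cong (typeOf blue) eq , lt)
    (match φ≢0 ¬p b∈ (j , eq , fit)) →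
      match (noPartial goods (blue-partial φ≢0) ¬p) b∈
        (gain ≡.refl ≡.refl (≡.sym (≡.cong (typeOf red) eq))
          (φ≢0 , goodGroup goods b∈ eq , fits⇒≢ i j (goodGroup goods b∈ eq) fit))
        (≡.cong (typeOf blue) eq)
    (new φ≢0 ¬p _) → new (noPartial goods (blue-partial φ≢0) ¬p) ≡.refl ≡.refl φ≢0

  placeBlue-noMatch : ∀ {i p B B′} → PlaceBlue i p B B′ → NoMatch B → NoMatch B′
  placeBlue-noMatch (only _ b∈ _)    nm i j x y = nm i j (Any-∷=⁻ b∈ id x) (Any-∷=⁻ b∈ id y)
  placeBlue-noMatch (newOnly _ _)    nm i j (there x) (there y) = nm i j x y
  placeBlue-noMatch (partial _ b∈ _) nm i j x y = nm i j (Any-∷=⁻ b∈ id x) (Any-∷=⁻ b∈ id y)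
  placeBlue-noMatch (match _ _ b∈ _) nm i j x y = nm i j (Any-∷=⁻ b∈ (λ ()) x) (Any-∷=⁻ b∈ (λ ()) y)
  placeBlue-noMatch (new _ _ ¬match) nm i j (here ≡.refl) (there y) fit =
    ¬match (Any.map (λ eq → j , eq , fit) y)
  placeBlue-noMatch (new _ _ ¬match) nm i j (there x)     (there y)     = nm i j x y

  -- Next Fit for the smallest type.

  smallSize : List (List Item) → Carrier
  smallSize = List.foldr (λ b x → sumOver size b + x) 0#

  -- The open bin is left out, so the invariant survives its closing.
  NextFitInvariant : List (List Item) → Set ℓ₂
  NextFitInvariant []       = 0# ≤ 0#
  NextFitInvariant (b ∷ bs) = ι (length bs) * (1# - ε) ≤ smallSize bs

  nextFit-size : ∀ {p S S′} → NextFit p S S′ → smallSize S′ ≈ size p + smallSize S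
  nextFit-size         first    = +-congʳ (+-identityʳ _)
  nextFit-size         (fits _) = +-assoc _ _ _
  nextFit-size         (next _) = +-congʳ (+-identityʳ _)

  nextFit-invariant : ∀ {p S S′} → size p ≤ ε → NextFit p S S′ → NextFitInvariant S → NextFitInvariant S′
  nextFit-invariant p≤ε first _ = ≤-reflexive (zeroˡ (1# - ε))
  nextFit-invariant p≤ε (fits _) inv = inv
  nextFit-invariant {p} p≤ε (next {b} {bs} ¬fits) inv = begin
    (1# + ι (length bs)) * (1# - ε)        ≈⟨ distribʳ (1# - ε) 1# (ι (length bs)) ⟩
    1# * (1# - ε) + ι (length bs) * (1# - ε)  ≤⟨ +-mono-≤ full inv ⟩
    sumOver size b + smallSize bs          ∎
    where
    open ≤-Reasoning
    -- The bin is closed because an item of size at most `ε` overflows it.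
    full : 1# * (1# - ε) ≤ sumOver size b
    full = +-cancelʳ-≤ ε (begin
      1# * (1# - ε) + ε      ≈⟨ +-congʳ (*-identityˡ (1# - ε)) ⟩
      1# - ε + ε             ≈⟨ x-y+y≈x 1# ε ⟩
      1#                     ≤⟨ <⇒≤ (≰⇒> ¬fits) ⟩
      size p + sumOver size b  ≤⟨ +-monoˡ-≤ (sumOver size b) p≤ε ⟩
      ε + sumOver size b     ≈⟨ +-comm ε (sumOver size b) ⟩
      sumOver size b + ε     ∎)

  small⇒size≤ε : ∀ p → type p ≡ fromℕ k → size p ≤ ε
  small⇒size≤ε p eq = ≡.subst (λ i → size p ≤ t (inject₁ i)) eq (proj₂ (proj₂ (classify p)))

  -- The proportion of red items.

  -- For m items of type i, n of them red.
  Rate : Fin k → ℕ → ℕ → Set ℓ₂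
  Rate i m n = ι n ≤ α i * ι m × α i * ι m ≤ ι (suc n)

  0≤αι : ∀ i m → 0# ≤ α i * ι m
  0≤αι i m = *-nonNegative (0≤α i) (0≤ι m)

  rate-initial : ∀ i → Rate i 0 0
  rate-initial i = ≤-reflexive (sym (zeroʳ (α i))) , ≤-respˡ-≈ (sym (zeroʳ (α i))) (0≤ι 1)

  -- The test that colours the item red is the lower estimate; the upper one moves by `α i ≤ 1`
  -- while its right side moves by 1.
  rate-red : ∀ {i m n} → n ℕ.< ⌊ α i * ι (suc m) ⌋ → Rate i m n → Rate i (suc m) (suc n)
  rate-red {i} {m} {n} n<⌊⌋ (_ , αm≤) =
    ≤-trans (ι-mono-≤ n<⌊⌋) (ι⌊x⌋≤x (0≤αι i (suc m))) , (begin
      α i * (1# + ι m)      ≈⟨ distribˡ (α i) 1# (ι m) ⟩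
      α i * 1# + α i * ι m  ≈⟨ +-congʳ (*-identityʳ (α i)) ⟩
      α i + α i * ι m       ≤⟨ +-mono-≤ (α≤1 i) αm≤ ⟩
      1# + ι (suc n)        ∎)
    where open ≤-Reasoning

  -- Here the failed test gives the upper estimate, as the floor is at most `n`; the lower one only
  -- gains room.
  rate-blue : ∀ {i m n} → ¬ (n ℕ.< ⌊ α i * ι (suc m) ⌋) → Rate i m n → Rate i (suc m) n
  rate-blue {i} {m} {n} n≮⌊⌋ (n≤ , _) =
    ≤-trans n≤ (*-monoˡ-≤ (0≤α i) (x≤1+x (ι m))) ,
    ≤-trans (<⇒≤ (x<ι[1+⌊x⌋] (α i * ι (suc m)))) (ι-mono-≤ (s≤s (ℕ.≮⇒≥ n≮⌊⌋)))

  -- A red item needs a positive floor of `α i * ι m`, but `γ i = 0` makes `α i` vanish.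
  red-step⇒γ≢0 : ∀ i m {n} → n ℕ.< ⌊ α i * ι m ⌋ → γ i ≢ 0
  red-step⇒γ≢0 i m n<⌊⌋ γ≡0 = <⇒≱ 0<1 (begin
    1#                ≤⟨ 1≤ι ⌊ α i * ι m ⌋ (ℕ.m<n⇒n≢0 n<⌊⌋) ⟩
    ι ⌊ α i * ι m ⌋   ≤⟨ ι⌊x⌋≤x (0≤αι i m) ⟩
    α i * ι m         ≈⟨ *-congʳ (γ≡0⇒α≈0 i γ≡0) ⟩
    0# * ι m          ≈⟨ zeroˡ (ι m) ⟩
    0#                ∎)
    where open ≤-Reasoning

  -- The invariant of a run.

  record Invariant (σ : State) : Set (c₀ ⊔ ℓ₁ ⊔ ℓ₂) where
    open State σ using (s; e; bins)
    field
      good      : All Good bins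
      noMatch   : NoMatch bins
      blueTally : ∀ i → slotSum blue i id bins ℕ.+ e i ≡ s i
      redTally  : ∀ i → slotSum red i id bins ≡ e i
      deficit   : ∀ c i → slotSum c i (capacity c i ∸_) bins ℕ.≤ capacity c i
      rate      : ∀ i → Rate i (s i) (e i)
      nextFit   : NextFitInvariant (State.small σ)

  invariant-initial : Invariant initial
  invariant-initial = record
    { good      = []
    ; noMatch   = λ _ _ ()
    ; blueTally = λ _ → ≡.refl
    ; redTally  = λ _ → ≡.refl
    ; deficit   = λ _ _ → z≤n
    ; rate      = rate-initial
    ; nextFit   = ≤-refl
    }

  invariant-step : ∀ {p σ σ′} → Step p σ σ′ → Invariant σ → Invariant σ′
  invariant-step {p} (small eq nf) inv = record
    { Invariant inv
    ; nextFit = nextFit-invariant (small⇒size≤ε p eq) nf (Invariant.nextFit inv)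
    }
  invariant-step {p} (red {s} {e} {B} {B′} i type≡ e<⌊⌋ place) inv = record
    { good      = fill-good type≡ fill good
    ; noMatch   = placeRed-noMatch place noMatch
    ; blueTally = blueTally′
    ; redTally  = redTally′
    ; deficit   = deficit′
    ; rate      = rate′
    ; nextFit   = nextFit
    }
    where
    open Invariant inv
    fill : Fill red i p B B′
    fill = placeRed⇒fill (red-step⇒γ≢0 i (suc (s i)) e<⌊⌋) good place

    blueTally′ : ∀ j → slotSum blue j id B′ ℕ.+ increment i e j ≡ increment i s j
    blueTally′ j rewrite fill-opposite type≡ fill j id with j Fin.≟ i
    ... | yes ≡.refl rewrite updateAt-updates i {suc} e | updateAt-updates i {suc} s =
      ≡.trans (ℕ.+-suc _ (e i)) (≡.cong suc (blueTally i))
    ... | no j≢i rewrite updateAt-minimal j i {suc} e j≢i | updateAt-minimal j i {suc} s j≢i =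
      blueTally j

    redTally′ : ∀ j → slotSum red j id B′ ≡ increment i e j
    redTally′ j with j Fin.≟ i
    ... | yes ≡.refl rewrite updateAt-updates i {suc} e =
      ≡.trans (fill-tally type≡ good fill) (≡.cong suc (redTally i))
    ... | no j≢i rewrite updateAt-minimal j i {suc} e j≢i =
      ≡.trans (fill-≢ type≡ fill j≢i id) (redTally j)

    deficit′ : ∀ c j → slotSum c j (capacity c j ∸_) B′ ℕ.≤ capacity c j
    deficit′ blue j rewrite fill-opposite type≡ fill j (capacity blue j ∸_) = deficit blue j
    deficit′ red  j with j Fin.≟ i
    ... | yes ≡.refl = fill-deficit type≡ good fill (deficit red i)
    ... | no j≢i rewrite fill-≢ type≡ fill j≢i (capacity red j ∸_) = deficit red j

    rate′ : ∀ j → Rate j (increment i s j) (increment i e j)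
    rate′ j with j Fin.≟ i
    ... | yes ≡.refl rewrite updateAt-updates i {suc} e | updateAt-updates i {suc} s =
      rate-red {m = s i} e<⌊⌋ (rate i)
    ... | no j≢i rewrite updateAt-minimal j i {suc} e j≢i | updateAt-minimal j i {suc} s j≢i = rate j
  invariant-step {p} (blue {s} {e} {B} {B′} i type≡ e≮⌊⌋ place) inv = record
    { good      = fill-good type≡ fill good
    ; noMatch   = placeBlue-noMatch place noMatch
    ; blueTally = blueTally′
    ; redTally  = λ j → ≡.trans (fill-opposite type≡ fill j id) (redTally j)
    ; deficit   = deficit′
    ; rate      = rate′
    ; nextFit   = nextFit
    }
    where
    open Invariant inv
    fill : Fill blue i p B B′
    fill = placeBlue⇒fill good place

    blueTally′ : ∀ j → slotSum blue j id B′ ℕ.+ e j ≡ increment i s j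
    blueTally′ j with j Fin.≟ i
    ... | yes ≡.refl rewrite updateAt-updates i {suc} s | fill-tally type≡ good fill =
      ≡.cong suc (blueTally i)
    ... | no j≢i rewrite updateAt-minimal j i {suc} s j≢i | fill-≢ type≡ fill j≢i id = blueTally j

    deficit′ : ∀ c j → slotSum c j (capacity c j ∸_) B′ ℕ.≤ capacity c j
    deficit′ red  j rewrite fill-opposite type≡ fill j (capacity red j ∸_) = deficit red j
    deficit′ blue j with j Fin.≟ i
    ... | yes ≡.refl = fill-deficit type≡ good fill (deficit blue i)
    ... | no j≢i rewrite fill-≢ type≡ fill j≢i (capacity blue j ∸_) = deficit blue j

    rate′ : ∀ j → Rate j (increment i s j) (e j)
    rate′ j with j Fin.≟ i
    ... | yes ≡.refl rewrite updateAt-updates i {suc} s = rate-blue {m = s i} e≮⌊⌋ (rate i)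
    ... | no j≢i rewrite updateAt-minimal j i {suc} s j≢i = rate j

  invariant-run : ∀ {L σ σ′} → Run L σ σ′ → Invariant σ → Invariant σ′
  invariant-run []           inv = inv
  invariant-run (step ∷ run) inv = invariant-run run (invariant-step step inv)

  -- The weight of the list, read off the state.

  value : (Fin k → Carrier) → State → Carrier
  value w σ = sum (λ i → ι (State.s σ i) * w i) + smallSize (State.small σ) / (1# - ε)

  value-initial : ∀ w → value w initial ≈ 0#
  value-initial w = trans (+-cong (sum-0 (λ i → zeroˡ (w i))) (zeroˡ _)) (+-identityˡ 0#)

  W-small : ∀ n p → type p ≡ fromℕ k → W n p ≈ size p / (1# - ε)
  W-small n p eq with type p | eq
  ... | .(fromℕ k) | ≡.refl rewrite view-fromℕ k = refl

  W-large : ∀ n p {i} → type p ≡ inject₁ i → W n p ≈ typeWeight n i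
  W-large n p {i} eq with type p | eq
  ... | .(inject₁ i) | ≡.refl rewrite view-inject₁ i = refl

  -- Weights ignore colour, so a red and a blue step have the same effect; `e` and the bins are left
  -- arbitrary on both sides to cover both.
  value-increment : ∀ n p {i} → type p ≡ inject₁ i → ∀ s {e e′ B B′} S →
                    value (typeWeight n) (state (increment i s) e′ B′ S) ≈
                    W n p + value (typeWeight n) (state s e B S)
  value-increment n p {i} eq s S = trans (+-congʳ (sum-bump i at-i elsewhere)) (+-assoc _ _ _)
    where
    at-i : ι (increment i s i) * typeWeight n i ≈ W n p + ι (s i) * typeWeight n i
    at-i rewrite updateAt-updates i {suc} s = trans (distribʳ (typeWeight n i) 1# (ι (s i)))
      (+-congʳ (trans (*-identityˡ (typeWeight n i)) (sym (W-large n p eq))))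
    elsewhere : ∀ j → j ≢ i → ι (increment i s j) * typeWeight n j ≈ ι (s j) * typeWeight n j
    elsewhere j j≢i rewrite updateAt-minimal j i {suc} s j≢i = refl

  value-step : ∀ n {p σ σ′} → Step p σ σ′ →
               value (typeWeight n) σ′ ≈ W n p + value (typeWeight n) σ
  value-step n {p} (small {s} {S = S} {S′} eq nf) = begin-equality
    N + smallSize S′ / d                 ≈⟨ +-congˡ (*-congʳ (nextFit-size nf)) ⟩
    N + (size p + smallSize S) / d
      ≈⟨ solve 4 (λ N x y d → N :+ (x :+ y) :* d := x :* d :+ (N :+ y :* d)) refl
           N (size p) (smallSize S) (d ⁻¹) ⟩
    size p / d + (N + smallSize S / d)   ≈⟨ +-congʳ (W-small n p eq) ⟨
    W n p + (N + smallSize S / d)        ∎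
    where
    open ≤-Reasoning
    open Solver
    d = 1# - ε
    N = sum (λ i → ι (s i) * typeWeight n i)
  value-step n {p} (red {s} {e} {B} {B′} {S} i eq _ _) =
    value-increment n p eq s {e} {increment i e} {B} {B′} S
  value-step n {p} (blue {s} {e} {B} {B′} {S} i eq _ _) =
    value-increment n p eq s {e} {e} {B} {B′} S

  value-run : ∀ n {L σ σ′} → Run L σ σ′ →
              value (typeWeight n) σ′ ≈ sumOver (W n) L + value (typeWeight n) σ
  value-run n [] = sym (+-identityˡ _)
  value-run n {p ∷ L} {σ} (step ∷ run) = trans (value-run n run)
    (trans (+-congˡ (value-step n step))
      (solve 3 (λ x y z → x :+ (y :+ z) := (y :+ x) :+ z) refl
        (sumOver (W n) L) (W n p) (value (typeWeight n) σ)))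
    where open Solver

  -- The number of bins of each colour and type.

  occupied : Colour → Fin k → List Bin → ℕ
  occupied c i = slotSum c i (const 1)

  -- Each bin of the class accounts for `m`, since its count and its shortfall from `m` add up to at
  -- least `m`.
  occupied*m≤ : ∀ c i m B → occupied c i B ℕ.* m ℕ.≤ slotSum c i id B ℕ.+ slotSum c i (m ∸_) B
  occupied*m≤ c i m []      = z≤n
  occupied*m≤ c i m (b ∷ B) = begin
    (slot c i (const 1) b ℕ.+ occupied c i B) ℕ.* m
      ≡⟨ ℕ.*-distribʳ-+ m (slot c i (const 1) b) (occupied c i B) ⟩
    slot c i (const 1) b ℕ.* m ℕ.+ occupied c i B ℕ.* m
      ≤⟨ ℕ.+-mono-≤ head≤ (occupied*m≤ c i m B) ⟩
    (slot c i id b ℕ.+ slot c i (m ∸_) b) ℕ.+ (slotSum c i id B ℕ.+ slotSum c i (m ∸_) B)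
      ≡⟨ ℕSolver.solve 4 (λ x y z w → (x :+ y) :+ (z :+ w) := (x :+ z) :+ (y :+ w)) ≡.refl
           (slot c i id b) (slot c i (m ∸_) b) (slotSum c i id B) (slotSum c i (m ∸_) B) ⟩
    slotSum c i id (b ∷ B) ℕ.+ slotSum c i (m ∸_) (b ∷ B) ∎
    where
    open ℕ.≤-Reasoning
    open ℕSolver using (_:+_; _:=_)
    head≤ : slot c i (const 1) b ℕ.* m ℕ.≤ slot c i id b ℕ.+ slot c i (m ∸_) b
    head≤ with occupied? (typeOf c (group b)) i
    ... | no  _ = z≤n
    ... | yes _ = ℕ.≤-trans (ℕ.≤-reflexive (ℕ.*-identityˡ m)) (ℕ.m≤n+m∸n m (count i b))

  -- The 2 consists of one bin for the deficit `m` and one for the rounding error of one item, which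
  -- is at most `m`.
  occupied-bound : ∀ N m n {a x w} → m ≢ 0 → N ℕ.* m ℕ.≤ n ℕ.+ m → ι n ≤ a * x + 1# →
                   w * ι m ≈ a → ι N ≤ w * x + ι 2
  occupied-bound N m n {a} {x} {w} m≢0 Nm≤ n≤ w≈ = *-cancelʳ-≤ (0<ι m m≢0) (begin
    ι N * ι m                ≈⟨ ι-* N m ⟨
    ι (N ℕ.* m)              ≤⟨ ι-mono-≤ Nm≤ ⟩
    ι (n ℕ.+ m)              ≈⟨ ι-+ n m ⟩
    ι n + ι m                ≤⟨ +-monoˡ-≤ (ι m) n≤ ⟩
    a * x + 1# + ι m         ≤⟨ +-monoˡ-≤ (ι m) (+-monoʳ-≤ (a * x) (1≤ι m m≢0)) ⟩
    a * x + ι m + ι m        ≈⟨ +-congʳ (+-congʳ (*-congʳ w≈)) ⟨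
    w * ι m * x + ι m + ι m
      ≈⟨ solve 3 (λ w m x → w :* m :* x :+ m :+ m := (w :* x :+ (con 1 :+ (con 1 :+ con 0))) :* m) refl
           w (ι m) x ⟩
    (w * x + ι 2) * ι m      ∎)
    where
    open ≤-Reasoning
    open Solver

  ½ : Carrier
  ½ = 1# / ι 2

  ½*2≈1 : ½ * ι 2 ≈ 1#
  ½*2≈1 = x/y*y≈x (>⇒≉0 (0<ι 2 λ ()))

  0≤½ : 0# ≤ ½
  0≤½ = 0≤x/y 0≤1 (0<ι 2 λ ())

  ½+½≈1 : ½ + ½ ≈ 1#
  ½+½≈1 = trans (solve 1 (λ x → x :+ x := x :* (con 1 :+ (con 1 :+ con 0))) refl ½) ½*2≈1
    where open Solver

  ½≤1 : ½ ≤ 1#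
  ½≤1 = ≤-respʳ-≈ ½+½≈1 (≤-respˡ-≈ (+-identityˡ ½) (+-monoˡ-≤ ½ 0≤½))

  share-one : ∀ x n → n ≢ 0 → x / ι (1 ℕ.* n) * ι n ≈ x
  share-one x n n≢0 rewrite ℕ.*-identityˡ n = x/y*y≈x (>⇒≉0 (0<ι n n≢0))

  share-two : ∀ x n → n ≢ 0 → x / ι (2 ℕ.* n) ≈ ½ * (x / ι (1 ℕ.* n))
  share-two x n n≢0 = *-cancelʳ-≈ 0<2n (begin-equality
    x / ι (2 ℕ.* n) * ι (2 ℕ.* n)              ≈⟨ x/y*y≈x (>⇒≉0 0<2n) ⟩
    x                                          ≈⟨ share-one x n n≢0 ⟨
    x₁ * ι n                                   ≈⟨ *-identityˡ _ ⟨
    1# * (x₁ * ι n)                            ≈⟨ *-congʳ ½*2≈1 ⟨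
    ½ * ι 2 * (x₁ * ι n)
      ≈⟨ solve 4 (λ h t y n → h :* t :* (y :* n) := h :* y :* (t :* n)) refl ½ (ι 2) x₁ (ι n) ⟩
    ½ * x₁ * (ι 2 * ι n)                       ≈⟨ *-congˡ (ι-* 2 n) ⟨
    ½ * x₁ * ι (2 ℕ.* n)                       ∎)
    where
    open ≤-Reasoning
    open Solver
    x₁ = x / ι (1 ℕ.* n)
    0<2n : 0# < ι (2 ℕ.* n)
    0<2n = 0<ι (2 ℕ.* n) (λ eq → n≢0 (ℕ.m+n≡0⇒m≡0 n eq))

  -- For `γ i = 0` the left side is 0 by the convention on the weights, and `α i` vanishes too.
  redShare-one : ∀ i → redShare 1 i * ι (γ i) ≈ α i
  redShare-one i with γ i | γ≡0⇒α≈0 i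
  ... | zero  | α≈0 = trans (zeroʳ 0#) (sym (α≈0 ≡.refl))
  ... | suc g | _   = share-one (α i) (suc g) λ ()

  redShare-two : ∀ i → redShare 2 i ≈ ½ * redShare 1 i
  redShare-two i with γ i
  ... | zero  = sym (zeroʳ ½)
  ... | suc g = share-two (α i) (suc g) λ ()

  0≤redShare : ∀ i → 0# ≤ redShare 1 i
  0≤redShare i with γ i
  ... | zero  = ≤-refl
  ... | suc g = 0≤x/y (0≤α i) (0<ι (1 ℕ.* suc g) λ ())

  blueShare-two : ∀ i → blueShare 2 i ≈ ½ * blueShare 1 i
  blueShare-two i = share-two (1# - α i) (β i) (β≢0 i)

  occupied≤ : ∀ c i {B} → slotSum c i (capacity c i ∸_) B ℕ.≤ capacity c i →
              occupied c i B ℕ.* capacity c i ℕ.≤ slotSum c i id B ℕ.+ capacity c i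
  occupied≤ c i {B} D≤ = ℕ.≤-trans (occupied*m≤ c i (capacity c i) B) (ℕ.+-monoʳ-≤ (slotSum c i id B) D≤)

  noRed⇒occupied≡0 : ∀ {i B} → γ i ≡ 0 → All Good B → occupied red i B ≡ 0
  noRed⇒occupied≡0 γ≡0 [] = ≡.refl
  noRed⇒occupied≡0 {i} {b ∷ B} γ≡0 ((good , _) ∷ goods) = ≡.cong₂ ℕ._+_
    (valueIf-≢ (const 1) (count i b) (λ eq → red⇒γ≢0 (group b) good eq γ≡0))
    (noRed⇒occupied≡0 γ≡0 goods)

  module _ {σ : State} (inv : Invariant σ) where
    open Invariant inv
    open State σ using (s; e; bins)

    occupied-blue : ∀ i → ι (occupied blue i bins) ≤ blueShare 1 i * ι (s i) + ι 2
    occupied-blue i = occupied-bound (occupied blue i bins) (β i) n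
      (β≢0 i) (occupied≤ blue i {bins} (deficit blue i))
      -- The blue items number `s i` minus `e i`, and `e i` is at least `α i * s i` minus 1; adding
      -- `α i * ι (s i)` to both sides avoids the subtraction.
      (+-cancelʳ-≤ (α i * ι (s i)) (begin
        ι n + α i * ι (s i)                             ≤⟨ +-monoʳ-≤ (ι n) (proj₂ (rate i)) ⟩
        ι n + (1# + ι (e i))
          ≈⟨ solve 2 (λ x y → x :+ (con 1 :+ y) := (x :+ y) :+ con 1) refl (ι n) (ι (e i)) ⟩
        (ι n + ι (e i)) + 1#                            ≈⟨ +-congʳ (ι-+ n (e i)) ⟨
        ι (n ℕ.+ e i) + 1#                              ≡⟨ ≡.cong (λ m → ι m + 1#) (blueTally i) ⟩
        ι (s i) + 1#
          ≈⟨ +-congʳ (trans (*-congʳ (x-y+y≈x 1# (α i))) (*-identityˡ (ι (s i)))) ⟨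
        (1# - α i + α i) * ι (s i) + 1#
          ≈⟨ solve 4 (λ x y z o → (x :+ y) :* z :+ o := x :* z :+ o :+ y :* z) refl
               (1# - α i) (α i) (ι (s i)) 1# ⟩
        (1# - α i) * ι (s i) + 1# + α i * ι (s i)       ∎))
      (share-one (1# - α i) (β i) (β≢0 i))
      where
      n = slotSum blue i id bins
      open ≤-Reasoning
      open Solver

    occupied-red : ∀ i → ι (occupied red i bins) ≤ redShare 1 i * ι (s i) + ι 2
    occupied-red i with γ i ℕ.≟ 0
    ... | no  γ≢0 = occupied-bound (occupied red i bins) (γ i) (slotSum red i id bins)
      γ≢0 (occupied≤ red i {bins} (deficit red i))
      (begin
        ι (slotSum red i id bins)  ≡⟨ ≡.cong ι (redTally i) ⟩
        ι (e i)                    ≤⟨ proj₁ (rate i) ⟩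
        α i * ι (s i)              ≤⟨ x≤1+x _ ⟩
        1# + α i * ι (s i)         ≈⟨ +-comm 1# _ ⟩
        α i * ι (s i) + 1#         ∎)
      (redShare-one i)
      where open ≤-Reasoning
    ... | yes γ≡0 rewrite noRed⇒occupied≡0 γ≡0 good =
      ≤-respˡ-≈ (+-identityˡ 0#) (+-mono-≤ (*-nonNegative (0≤redShare i) (0≤ι (s i))) (0≤ι 2))

  -- From bins to weights.

  sum-slot : ∀ (u : Fin k → Carrier) m (n : Fin k → ℕ) →
             sum (λ i → u i * ι (valueIf (const 1) i m (n i))) ≈ maybe′ u 0# m
  sum-slot u nothing n = sum-0 (λ i → zeroʳ (u i))
  sum-slot u (just i) n =
    trans (sum-bump {f = λ _ → 0#} i at-i elsewhere)
      (trans (+-congˡ (sum-0 {k} (λ _ → refl))) (+-identityʳ (u i)))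
    where
    at-i : u i * ι (valueIf (const 1) i (just i) (n i)) ≈ u i + 0#
    at-i rewrite valueIf-≡ (const 1) {i} (n i) ≡.refl =
      trans (*-congˡ ι1≈1) (trans (*-identityʳ (u i)) (sym (+-identityʳ (u i))))
    elsewhere : ∀ j → j ≢ i → u j * ι (valueIf (const 1) j (just i) (n j)) ≈ 0#
    elsewhere j j≢i rewrite valueIf-≢ (const 1) {j} (n j) (just≢just j≢i ≡.refl) =
      zeroʳ (u j)

  groupWeight : (u v : Fin k → Carrier) → Group → Carrier
  groupWeight u v g = maybe′ u 0# (typeOf blue g) + maybe′ v 0# (typeOf red g)

  -- Double counting: the factors summed bin by bin equal those summed type by type, and each bin
  -- receives at least 1.
  bins≤occupied : ∀ u v {B} → All (λ b → 1# ≤ groupWeight u v (group b)) B →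
    ι (length B) ≤ sum (λ i → u i * ι (occupied blue i B) + v i * ι (occupied red i B))
  bins≤occupied u v [] = ≤-reflexive (sym (sum-0 (λ i →
    trans (+-cong (zeroʳ (u i)) (zeroʳ (v i))) (+-identityˡ 0#))))
  bins≤occupied u v {b ∷ B} (1≤ ∷ covers) = begin
    1# + ι (length B)                         ≤⟨ +-mono-≤ 1≤ (bins≤occupied u v covers) ⟩
    groupWeight u v (group b) + sum rest
      ≈⟨ +-congʳ (+-cong (sum-slot u (typeOf blue (group b)) (λ i → count i b))
           (sum-slot v (typeOf red (group b)) (λ i → count i b))) ⟨
    sum head-blue + sum head-red + sum rest   ≈⟨ +-congʳ (∑-distrib-+ head-blue head-red) ⟨
    sum (λ i → head-blue i + head-red i) + sum rest
      ≈⟨ ∑-distrib-+ (λ i → head-blue i + head-red i) rest ⟨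
    sum (λ i → head-blue i + head-red i + rest i)    ≈⟨ sum-cong-≋ combine ⟩
    sum (λ i → u i * ι (occupied blue i (b ∷ B)) + v i * ι (occupied red i (b ∷ B)))  ∎
    where
    open ≤-Reasoning
    open Solver
    head-blue head-red rest : Fin k → Carrier
    head-blue i = u i * ι (slot blue i (const 1) b)
    head-red  i = v i * ι (slot red i (const 1) b)
    rest      i = u i * ι (occupied blue i B) + v i * ι (occupied red i B)
    combine : ∀ i → head-blue i + head-red i + rest i ≈
                    u i * ι (occupied blue i (b ∷ B)) + v i * ι (occupied red i (b ∷ B))
    combine i = trans
      (solve 6 (λ u v x y X Y → u :* x :+ v :* y :+ (u :* X :+ v :* Y) :=
                            u :* (x :+ X) :+ v :* (y :+ Y)) refl
        (u i) (v i) (ι (slot blue i (const 1) b)) (ι (slot red i (const 1) b))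
        (ι (occupied blue i B)) (ι (occupied red i B)))
      (sym (+-cong (*-congˡ (ι-+ (slot blue i (const 1) b) (occupied blue i B)))
                   (*-congˡ (ι-+ (slot red i (const 1) b) (occupied red i B)))))

  0≤sumSize : ∀ b → 0# ≤ sumOver size b
  0≤sumSize []      = ≤-refl
  0≤sumSize (p ∷ b) = ≤-respˡ-≈ (+-identityˡ 0#) (+-mono-≤ (<⇒≤ (0<size p)) (0≤sumSize b))

  small≤ : ∀ S → NextFitInvariant S → ι (length S) ≤ smallSize S / (1# - ε) + 1#
  small≤ []       _   = ≤-respˡ-≈ (+-identityˡ 0#) (+-mono-≤ (≤-reflexive (sym (zeroˡ _))) 0≤1)
  small≤ (b ∷ bs) inv = ≤-respʳ-≈ (+-comm 1# _) (+-monoʳ-≤ 1# (*-cancelʳ-≤ 0<1-ε (begin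
    ι (length bs) * (1# - ε)              ≤⟨ inv ⟩
    smallSize bs                          ≈⟨ +-identityˡ _ ⟨
    0# + smallSize bs                     ≤⟨ +-monoˡ-≤ (smallSize bs) (0≤sumSize b) ⟩
    smallSize (b ∷ bs)                    ≈⟨ x/y*y≈x (>⇒≉0 0<1-ε) ⟨
    smallSize (b ∷ bs) / (1# - ε) * (1# - ε)  ∎)))
    where open ≤-Reasoning

  -- Each type loses at most 2 for its blue and 2 for its red bins, as the factors are at most 1;
  -- the final 1 is the open bin of Next Fit.
  constant : Carrier
  constant = sum {k} (λ _ → ι 4) + 1#

  -- Non-negativity lets the bounds on `occupied` be multiplied by the factors; the upper bound 1
  -- keeps their error terms independent of the list.
  record Multipliers (w : Fin k → Carrier) : Set (c₀ ⊔ ℓ₁ ⊔ ℓ₂) where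
    field
      u v    : Fin k → Carrier
      0≤u    : ∀ i → 0# ≤ u i
      u≤1    : ∀ i → u i ≤ 1#
      0≤v    : ∀ i → 0# ≤ v i
      v≤1    : ∀ i → v i ≤ 1#
      weight : ∀ i → w i ≈ u i * blueShare 1 i + v i * redShare 1 i

  binsUsed≤value : ∀ {w σ} (M : Multipliers w) → let open Multipliers M in Invariant σ →
    All (λ b → 1# ≤ groupWeight u v (group b)) (State.bins σ) → ι (binsUsed σ) ≤ value w σ + constant
  binsUsed≤value {w} {state s e B S} M inv covers = begin
    ι (length B ℕ.+ length S)      ≈⟨ ι-+ (length B) (length S) ⟩
    ι (length B) + ι (length S)    ≤⟨ +-mono-≤ large≤ (small≤ S (Invariant.nextFit inv)) ⟩
    (N + D) + (T + 1#)
      ≈⟨ solve 4 (λ N D T o → (N :+ D) :+ (T :+ o) := (N :+ T) :+ (D :+ o)) refl N D T 1# ⟩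
    (N + T) + constant             ∎
    where
    open ≤-Reasoning
    open Solver
    open Multipliers M
    N = sum (λ i → ι (s i) * w i)
    D = sum {k} (λ _ → ι 4)
    T = smallSize S / (1# - ε)

    each : ∀ i → u i * ι (occupied blue i B) + v i * ι (occupied red i B) ≤ ι (s i) * w i + ι 4
    each i = begin
      u i * ι (occupied blue i B) + v i * ι (occupied red i B)
        ≤⟨ +-mono-≤ (*-monoˡ-≤ (0≤u i) (occupied-blue inv i)) (*-monoˡ-≤ (0≤v i) (occupied-red inv i)) ⟩
      u i * (blueShare 1 i * x + ι 2) + v i * (redShare 1 i * x + ι 2)
        ≈⟨ solve 6 (λ u b v r x t → u :* (b :* x :+ t) :+ v :* (r :* x :+ t) :=
                                  x :* (u :* b :+ v :* r) :+ (u :* t :+ v :* t))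
             refl (u i) (blueShare 1 i) (v i) (redShare 1 i) x (ι 2) ⟩
      x * (u i * blueShare 1 i + v i * redShare 1 i) + (u i * ι 2 + v i * ι 2)
        ≈⟨ +-congʳ (*-congˡ (weight i)) ⟨
      x * w i + (u i * ι 2 + v i * ι 2)
        ≤⟨ +-monoʳ-≤ (x * w i) (+-mono-≤ (*-monoʳ-≤ (0≤ι 2) (u≤1 i)) (*-monoʳ-≤ (0≤ι 2) (v≤1 i))) ⟩
      x * w i + (1# * ι 2 + 1# * ι 2)
        ≈⟨ +-congˡ (trans (+-cong (*-identityˡ (ι 2)) (*-identityˡ (ι 2))) (sym (ι-+ 2 2))) ⟩
      x * w i + ι 4 ∎
      where x = ι (s i)

    large≤ : ι (length B) ≤ N + D
    large≤ = begin
      ι (length B)                    ≤⟨ bins≤occupied u v covers ⟩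
      sum (λ i → u i * ι (occupied blue i B) + v i * ι (occupied red i B))
                                      ≤⟨ sum-mono-≤ each ⟩
      sum (λ i → ι (s i) * w i + ι 4) ≈⟨ ∑-distrib-+ (λ i → ι (s i) * w i) (λ _ → ι 4) ⟩
      N + D                           ∎

  -- The choice of the weighting function.

  HasRed : Fin k → List Bin → Set _
  HasRed j = Any (λ b → group b ≡ red? j)

  leastRed : ∀ B → (∀ j → ¬ HasRed j B) ⊎
             ∃ λ j₀ → HasRed j₀ B × (∀ j → HasRed j B → toℕ (varphi j₀) ℕ.≤ toℕ (varphi j))
  leastRed [] = inj₁ (λ _ ())
  leastRed (bin g _ ∷ B) with leastRed B | isRed? g
    where
    isRed? : ∀ g → (∃ λ j → g ≡ red? j) ⊎ (∀ j → g ≢ red? j)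
    isRed? (only _)    = inj₂ λ _ ()
    isRed? (blue? _)   = inj₂ λ _ ()
    isRed? (red? j)    = inj₁ (j , ≡.refl)
    isRed? (mixed _ _) = inj₂ λ _ ()
  ... | inj₁ none | inj₂ g≢ = inj₁ λ where
    j (here eq)   → g≢ j eq
    j (there any) → none j any
  ... | inj₁ none | inj₁ (j₀ , ≡.refl) = inj₂ (j₀ , here ≡.refl , λ where
    j (here ≡.refl) → ℕ.≤-refl
    j (there any)   → contradiction any (none j))
  ... | inj₂ (j₀ , any₀ , least) | inj₂ g≢ = inj₂ (j₀ , there any₀ , λ where
    j (here eq)   → contradiction eq (g≢ j)
    j (there any) → least j any)
  ... | inj₂ (j₀ , any₀ , least) | inj₁ (j₁ , ≡.refl)
    with ℕ.≤-total (toℕ (varphi j₀)) (toℕ (varphi j₁))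
  ...   | inj₁ ≤₁ = inj₂ (j₀ , there any₀ , λ where
    j (here ≡.refl) → ≤₁
    j (there any)   → least j any)
  ...   | inj₂ ≤₀ = inj₂ (j₁ , here ≡.refl , λ where
    j (here ≡.refl) → ℕ.≤-refl
    j (there any)   → ℕ.≤-trans ≤₀ (least j any))

  blueOnly : Multipliers (typeWeight 1)
  blueOnly = record
    { u      = λ _ → 1#
    ; v      = λ _ → 0#
    ; 0≤u    = λ _ → 0≤1
    ; u≤1    = λ _ → ≤-refl
    ; 0≤v    = λ _ → ≤-refl
    ; v≤1    = λ _ → 0≤1
    ; weight = λ i → sym (trans (+-cong (*-identityˡ _) (zeroˡ _)) (+-identityʳ _))
    }

  -- For `K = 0` the index `suc K` is 1, and `typeWeight` takes its first clause instead.
  typeWeight-last : K ≢ 0 → typeWeight (suc K) ≡ lastWeight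
  typeWeight-last K≢0 with suc K ℕ.≟ 1 | suc K ℕ.≟ suc K
  ... | yes eq | _      = contradiction (ℕ.suc-injective eq) K≢0
  ... | no  _  | yes _  = ≡.refl
  ... | no  _  | no neq = contradiction ≡.refl neq

  -- The index K+2-h is written as in `maxWeight`; it is never 1, and it equals K+1 only for
  -- `h = 1`, which `2 ≤ h` excludes.
  typeWeight-middle : ∀ {h} → 2 ℕ.≤ h → h ℕ.≤ K → typeWeight (2 ℕ.+ (K ∸ h)) ≡ middleWeight h
  typeWeight-middle {h} 2≤h h≤K with 2 ℕ.+ (K ∸ h) ℕ.≟ 1 | 2 ℕ.+ (K ∸ h) ℕ.≟ suc K
  ... | no _ | yes eq = contradiction 2≤h (ℕ.<⇒≱ (s≤s (ℕ.≤-reflexive h≡1)))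
    where
    h≡1 : h ≡ 1
    h≡1 = ℕ.+-cancelˡ-≡ (K ∸ h) h 1 (≡.trans (ℕ.m∸n+n≡m h≤K)
      (≡.trans (≡.sym (ℕ.suc-injective eq)) (ℕ.+-comm 1 (K ∸ h))))
  ... | no _ | no _ = ≡.cong middleWeight (begin
    K ℕ.+ 2 ∸ (2 ℕ.+ (K ∸ h))  ≡⟨ ≡.cong (_∸ (2 ℕ.+ (K ∸ h))) (ℕ.+-comm K 2) ⟩
    2 ℕ.+ K ∸ (2 ℕ.+ (K ∸ h))  ≡⟨⟩
    K ∸ (K ∸ h)                ≡⟨ ℕ.m∸[m∸n]≡n h≤K ⟩
    h                          ∎)
    where open ≡.≡-Reasoning

  -- Under W^{K+2-h}, a class counts fully if its bins can remain unmatched when h is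
  -- the least varphi of a pure red bin, and with factor lo otherwise.
  module Threshold (h : ℕ) (lo : Carrier) where
    u v : Fin k → Carrier
    u i = if does (toℕ (φ i) ℕ.<? h) then 1# else lo
    v j = if does (toℕ (varphi j) ℕ.<? h) then lo else 1#

    u-below : ∀ i → toℕ (φ i) ℕ.< h → u i ≡ 1#
    u-below i lt rewrite dec-true (toℕ (φ i) ℕ.<? h) lt = ≡.refl

    u-above : ∀ i → ¬ (toℕ (φ i) ℕ.< h) → u i ≡ lo
    u-above i ≮h rewrite dec-false (toℕ (φ i) ℕ.<? h) ≮h = ≡.refl

    v-below : ∀ j → toℕ (varphi j) ℕ.< h → v j ≡ lo
    v-below j lt rewrite dec-true (toℕ (varphi j) ℕ.<? h) lt = ≡.refl

    v-above : ∀ j → h ℕ.≤ toℕ (varphi j) → v j ≡ 1#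
    v-above j ≤h rewrite dec-false (toℕ (varphi j) ℕ.<? h) (ℕ.≤⇒≯ ≤h) = ≡.refl

    module _ (0≤lo : 0# ≤ lo) (lo≤1 : lo ≤ 1#) where
      lo≤u : ∀ i → lo ≤ u i
      lo≤u i with does (toℕ (φ i) ℕ.<? h)
      ... | true  = lo≤1
      ... | false = ≤-refl

      u≤1 : ∀ i → u i ≤ 1#
      u≤1 i with does (toℕ (φ i) ℕ.<? h)
      ... | true  = ≤-refl
      ... | false = lo≤1

      lo≤v : ∀ j → lo ≤ v j
      lo≤v j with does (toℕ (varphi j) ℕ.<? h)
      ... | true  = ≤-refl
      ... | false = lo≤1

      v≤1 : ∀ j → v j ≤ 1#
      v≤1 j with does (toℕ (varphi j) ℕ.<? h)
      ... | true  = lo≤1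
      ... | false = ≤-refl

      multipliers : ∀ {w} → (∀ i → w i ≈ u i * blueShare 1 i + v i * redShare 1 i) → Multipliers w
      multipliers weight = record
        { u      = u
        ; v      = v
        ; 0≤u    = λ i → ≤-trans 0≤lo (lo≤u i)
        ; u≤1    = u≤1
        ; 0≤v    = λ j → ≤-trans 0≤lo (lo≤v j)
        ; v≤1    = v≤1
        ; weight = weight
        }

  -- An index is below 1 exactly when it is 0, so the four clauses of `lastWeight` are the threshold
  -- 1 with lower factor 0.
  lastWeight-threshold : ∀ i → let open Threshold 1 0# in
                         lastWeight i ≈ u i * blueShare 1 i + v i * redShare 1 i
  lastWeight-threshold i with φ i | varphi i
  ... | zero  | zero  = sym (trans (+-cong (*-identityˡ _) (zeroˡ _)) (+-identityʳ _))
  ... | zero  | suc _ = sym (+-cong (*-identityˡ _) (*-identityˡ _))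
  ... | suc _ | zero  = sym (trans (+-cong (zeroˡ _) (zeroˡ _)) (+-identityʳ _))
  ... | suc _ | suc _ = sym (trans (+-cong (zeroˡ _) (*-identityˡ _)) (+-identityˡ _))

  middleWeight-threshold : ∀ h i → let open Threshold h ½ in
                           middleWeight h i ≈ u i * blueShare 1 i + v i * redShare 1 i
  middleWeight-threshold h i with toℕ (φ i) ℕ.<? h | toℕ (varphi i) ℕ.<? h
  ... | yes p | yes q rewrite Threshold.u-below h ½ i p | Threshold.v-below h ½ i q =
    +-cong (sym (*-identityˡ _)) (redShare-two i)
  ... | yes p | no  q rewrite Threshold.u-below h ½ i p | Threshold.v-above h ½ i (ℕ.≮⇒≥ q) =
    +-cong (sym (*-identityˡ _)) (sym (*-identityˡ _))
  ... | no  p | no  q rewrite Threshold.u-above h ½ i p | Threshold.v-above h ½ i (ℕ.≮⇒≥ q) =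
    +-cong (blueShare-two i) (sym (*-identityˡ _))
  ... | no  p | yes q rewrite Threshold.u-above h ½ i p | Threshold.v-below h ½ i q =
    +-cong (blueShare-two i) (redShare-two i)

  -- Hides whether the lower factor is 0 or 1/2, so that the final argument is the same for `h = 1`
  -- and `h ≥ 2`.
  record ThresholdWeight (h : ℕ) : Set (c₀ ⊔ ℓ₁ ⊔ ℓ₂) where
    field lo : Carrier
    open Threshold h lo public
    field
      0≤lo    : 0# ≤ lo
      lo≤1    : lo ≤ 1#
      weight  : ∀ i → typeWeight (2 ℕ.+ (K ∸ h)) i ≈ u i * blueShare 1 i + v i * redShare 1 i
      1≤mixed : ∀ i j → γ j ≢ 0 → 1# ≤ u i + v j

  thresholdWeight : ∀ {h} → 1 ℕ.≤ h → h ℕ.≤ K → ThresholdWeight h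
  thresholdWeight {1} _ 1≤K = record
    { lo      = 0#
    ; 0≤lo    = ≤-refl
    ; lo≤1    = 0≤1
    ; weight  = weight
    -- The red side alone pays for the bin: a type with `γ j ≢ 0` has `varphi j ≥ 1`, so its factor
    -- is 1.
    ; 1≤mixed = λ i j γ≢0 → ≤-respˡ-≈ (+-identityˡ 1#) (+-mono-≤ (lo≤u ≤-refl 0≤1 i)
        (≤-reflexive (reflexive (≡.sym (v-above j (1≤varphi j γ≢0))))))
    }
    where
    open Threshold 1 0# hiding (u≤1; v≤1)
    weight : ∀ i → typeWeight (2 ℕ.+ (K ∸ 1)) i ≈ u i * blueShare 1 i + v i * redShare 1 i
    weight i = trans (reflexive (≡.cong-app (≡.trans (≡.cong typeWeight (≡.cong suc (ℕ.m+[n∸m]≡n 1≤K)))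
      (typeWeight-last (ℕ.m<n⇒n≢0 1≤K))) i)) (lastWeight-threshold i)
    1≤varphi : ∀ j → γ j ≢ 0 → 1 ℕ.≤ toℕ (varphi j)
    1≤varphi j γ≢0 = ℕ.n≢0⇒n>0 (λ eq → proj₁ (varphi-spec j γ≢0) (Fin.toℕ-injective eq))
  thresholdWeight {suc (suc h)} _ h≤K = record
    { lo      = ½
    ; 0≤lo    = 0≤½
    ; lo≤1    = ½≤1
    ; weight  = weight
    ; 1≤mixed = λ i j _ → ≤-respˡ-≈ ½+½≈1 (+-mono-≤ (lo≤u 0≤½ ½≤1 i) (lo≤v 0≤½ ½≤1 j))
    }
    where
    open Threshold (suc (suc h)) ½ hiding (u≤1; v≤1)
    weight : ∀ i → typeWeight (2 ℕ.+ (K ∸ suc (suc h))) i ≈ u i * blueShare 1 i + v i * redShare 1 i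
    weight i = trans (reflexive (≡.cong-app (typeWeight-middle (s≤s (s≤s z≤n)) h≤K) i))
      (middleWeight-threshold (suc (suc h)) i)

  -- The bound on the number of bins.

  open Extrema totalOrder using (⊥≤max; xs≤max)

  first≤maxWeight : ∀ L → sumOver (W 1) L ≤ maxWeight L
  first≤maxWeight L = ⊥≤max _ (applyUpTo (λ m → sumOver (W (2 ℕ.+ m)) L) K)

  later≤maxWeight : ∀ {m} L → m ℕ.< K → sumOver (W (2 ℕ.+ m)) L ≤ maxWeight L
  later≤maxWeight L m<K = All.lookup (xs≤max (sumOver (W 1) L) _) (∈-applyUpTo⁺ _ m<K)

  value≤ : ∀ n {L σ} → Run L initial σ → value (typeWeight n) σ ≤ sumOver (W n) L
  value≤ n run = ≤-reflexive (trans (value-run n run)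
    (trans (+-congˡ (value-initial (typeWeight n))) (+-identityʳ _)))

  1≤1+x : ∀ {x} → 0# ≤ x → 1# ≤ 1# + x
  1≤1+x 0≤x = ≤-respˡ-≈ (+-identityʳ 1#) (+-monoʳ-≤ 1# 0≤x)

  bound : ∀ L σ → Run L initial σ → ι (binsUsed σ) ≤ maxWeight L + constant
  bound L σ run with leastRed (State.bins σ)
  ... | inj₁ none = begin
    ι (binsUsed σ)                     ≤⟨ binsUsed≤value blueOnly inv (All.tabulate covers) ⟩
    value (typeWeight 1) σ + constant  ≤⟨ +-monoˡ-≤ constant (value≤ 1 run) ⟩
    sumOver (W 1) L + constant         ≤⟨ +-monoˡ-≤ constant (first≤maxWeight L) ⟩
    maxWeight L + constant             ∎
    where
    open ≤-Reasoning
    inv = invariant-run run invariant-initial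
    covers : ∀ {b} → b ∈ State.bins σ → 1# ≤ groupWeight (λ _ → 1#) (λ _ → 0#) (group b)
    covers {bin (only _) _}    _  = 1≤1+x ≤-refl
    covers {bin (blue? _) _}   _  = 1≤1+x ≤-refl
    covers {bin (red? j) _}    b∈ = contradiction (lose b∈ ≡.refl) (none j)
    covers {bin (mixed _ _) _} _  = 1≤1+x ≤-refl
  ... | inj₂ (j₀ , red₀ , least) = begin
    ι (binsUsed σ)
      ≤⟨ binsUsed≤value (multipliers 0≤lo lo≤1 weight) inv (All.tabulate covers) ⟩
    value (typeWeight n) σ + constant  ≤⟨ +-monoˡ-≤ constant (value≤ n run) ⟩
    sumOver (W n) L + constant         ≤⟨ +-monoˡ-≤ constant (later≤maxWeight L K∸h<K) ⟩
    maxWeight L + constant             ∎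
    where
    open ≤-Reasoning
    inv = invariant-run run invariant-initial
    open Invariant inv using (good; noMatch)
    h = toℕ (varphi j₀)
    n = 2 ℕ.+ (K ∸ h)

    γ≢0 : ∀ {j} → HasRed j (State.bins σ) → γ j ≢ 0
    γ≢0 any = let b , b∈ , eq = find∈ any in goodGroup good b∈ eq

    1≤h : 1 ℕ.≤ h
    1≤h = ℕ.n≢0⇒n>0 (λ eq → proj₁ (varphi-spec j₀ (γ≢0 red₀)) (Fin.toℕ-injective eq))
    h≤K : h ℕ.≤ K
    h≤K = Fin.toℕ≤pred[n] (varphi j₀)
    -- As `h ≥ 1`, the chosen function is one of the `K` listed after `W 1` in `maxWeight`.
    K∸h<K : K ∸ h ℕ.< K
    K∸h<K = ℕ.∸-monoʳ-< 1≤h h≤K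

    open ThresholdWeight (thresholdWeight 1≤h h≤K)

    1≤u+0 : ∀ i → toℕ (φ i) ℕ.< h → 1# ≤ u i + 0#
    1≤u+0 i φ<h rewrite u-below i φ<h = 1≤1+x ≤-refl

    covers : ∀ {b} → b ∈ State.bins σ → 1# ≤ groupWeight u v (group b)
    covers {bin (only i) _}    b∈ =
      1≤u+0 i (≡.subst (λ m → toℕ m ℕ.< h) (≡.sym (goodGroup good b∈ ≡.refl)) 1≤h)
    covers {bin (blue? i) _}   b∈ = 1≤u+0 i (¬fits⇒φ<varphi i j₀ (γ≢0 red₀)
      (noMatch i j₀ (lose b∈ ≡.refl) red₀))
    -- Minimality of `h` among the pure red bins gives every one of them factor 1.
    covers {bin (red? j) _}    b∈ rewrite v-above j (least j (lose b∈ ≡.refl)) =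
      ≤-reflexive (sym (+-identityˡ 1#))
    covers {bin (mixed i j) _} b∈ = 1≤mixed i j (proj₁ (proj₂ (goodGroup good b∈ ≡.refl)))

theorem1 : ∀ {c ℓ₁ ℓ₂} (F : ArchimedeanOrderedField c ℓ₁ ℓ₂) (P : Parameters F) →
    let open ArchimedeanOrderedField F
        open SuperHarmonic F P
    in ∃ λ (C : Carrier) → ∀ (L : List Item) (σ : State) → Run L initial σ →
         ι (binsUsed σ) ≤ maxWeight L + C
theorem1 F P = Bound.constant F P , Bound.bound F P
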